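{- For every integer $n\ge 1$, the poset $P^A_n$ is rank-symmetric, rank-unimodal and strongly Sperner, and its rank generating function is equal to that of $NC^A_n$.
   Context: Let $[n]=\{1,2,\dots,n\}$. A set partition $\pi$ of $[n]$ is noncrossing if there are no four elements $1\le a<b<c<d\le n$ such that $a,c$ lie in one block of $\pi$ and $b,d$ lie in a different block of $\pi$. $NC^A_n$ is the set of noncrossing partitions of $[n]$ ordered by refinement: $\pi\le\nu$ if each block of $\nu$ is a union of blocks of $\pi$. It is a ranked poset with rank function $\mathrm{rk}(\pi)=n-\mathrm{bk}(\pi)$, where $\mathrm{bk}(\pi)$ is the number of blocks of $\pi$. A permutation $p=p_1p_2\cdots p_n$ of $[n]$ (one-line notation) is 132-avoiding if there are no positions $1\le a<b<c\le n$ with $p_a<p_c<p_b$. Its descent set is $\mathrm{Des}(p)=\{i\in[n-1] : p_i>p_{i+1}\}$. $P^A_n$ is the poset whose elements are the 132-avoiding permutations of $[n]$, with strict order $p<q$ if and only if $\mathrm{Des}(p)\subsetneq\mathrm{Des}(q)$ (so distinct permutations with the same descent set are incomparable). It is a ranked poset with rank function $\mathrm{rk}(p)=\#\mathrm{Des}(p)$. For a finite ranked poset whose ranks run over $0,1,\dots,r$, with $w_k$ elements of rank $k$: the rank generating function is $\sum_{k=0}^r w_kx^k$; the poset is rank-symmetric if $w_k=w_{r-k}$ for all $k$; rank-unimodal if $w_0\le\cdots\le w_j\ge\cdots\ge w_r$ for some $j$; and strongly Sperner if for every $k\geq 1$ the maximum cardinality of a union of $k$ antichains equals the sum of the $k$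 largest rank sizes. -}

module Defs where

open import Data.Bool.Base using (true; false)
import Data.Bool.Properties as Bool
import Data.Empty as Empty
open import Data.Fin.Base using (Fin; zero; suc; inject₁; fromℕ; punchIn; _<_; _≤_)
open import Data.Fin.Permutation as Perm using (Permutation′; _⟨$⟩ʳ_; insert; remove)
import Data.Fin.Properties as Fin
open import Data.Fin.Subset
  using (Subset; Side; inside; outside; ⊥; ⁅_⁆; _∈_; _∉_; _⊆_; _⊂_; _∩_; _∪_; _─_; ⋃; ∣_∣; Nonempty; Empty)
import Data.Fin.Subset.Properties as Subset
open import Data.List.Base as List
  using (List; []; _∷_; _++_; length; filter; upTo; take; lookup; allFin; cartesianProductWith)
open import Data.List.Extrema.Nat using (max)
open import Data.List.Membership.Propositional using (find; lose) renaming (_∈_ to _∈ₗ_)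
import Data.List.Membership.Propositional.Properties as ∈ₗ
open import Data.List.Membership.Propositional.Properties.WithK using (unique∧set⇒bag)
import Data.List.Membership.Setoid as SetoidMembership
import Data.List.Membership.Setoid.Properties as SetoidMembershipₚ
open import Data.List.Properties using (filter-all; length-map; length-tabulate)
open import Data.List.Relation.Binary.BagAndSetEquality
  using (_∼[_]_; set; ∼bag⇒↭)
open import Data.List.Relation.Binary.Permutation.Propositional.Properties using (↭-length)
open import Data.List.Relation.Unary.All as All using (All; []; _∷_)
import Data.List.Relation.Unary.All.Properties as All
open import Data.List.Relation.Unary.AllPairs as AllPairs using (AllPairs; []; _∷_)
import Data.List.Relation.Unary.AllPairs.Properties as AllPairs
open import Data.List.Relation.Unary.Any as Any using (Any; here; there)
import Data.List.Relation.Unary.Any.Properties as Any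
open import Data.List.Relation.Unary.Unique.Propositional using (Unique)
import Data.List.Relation.Unary.Unique.Propositional.Properties as Unique
import Data.List.Relation.Unary.Unique.Setoid as SetoidUnique
import Data.List.Relation.Unary.Unique.Setoid.Properties as SetoidUniqueₚ
import Data.List.Sort as Sort
open import Data.Nat.ListAction using (sum)
open import Data.Nat.Base as ℕ using (ℕ; zero; suc; pred; _∸_)
import Data.Nat.Properties as ℕ
open import Data.Product.Base using (∃; _×_; _,_; proj₁; proj₂)
open import Data.Sum.Base using (_⊎_; inj₁; inj₂)
open import Data.Vec.Base using ([]; _∷_; here; there; tabulate)
import Data.Vec.Properties as Vec
open import Function.Base using (_∘_)
open import Function.Bundles using (_⇔_; mk⇔; Equivalence; Injection)
open import Function.Construct.Composition using (_⇔-∘_)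
open import Function.Construct.Identity using (⇔-id)
open import Function.Construct.Symmetry using (⇔-sym)
open import Function.Properties.Inverse using (↔⇒↣)
open import Level using (0ℓ)
open import Relation.Binary.Bundles using (Poset; Setoid; StrictPartialOrder)
open import Relation.Binary.Core using (Rel)
import Relation.Binary.Construct.Flip.EqAndOrd as Flip
import Relation.Binary.Construct.On as On
import Relation.Binary.Construct.StrictToNonStrict as StrictToNonStrict
open import Relation.Binary.PropositionalEquality
  using (_≡_; _≢_; refl; sym; trans; cong; cong₂; subst; setoid)
import Relation.Binary.Properties.Poset as StrictOrder
open import Relation.Nullary.Decidable using (Dec; yes; no; does; does-⇔; dec-true; dec-false; _→-dec_; _×-dec_; map′; ¬?)
open import Relation.Nullary.Negation using (¬_; contradiction)
open import Relation.Unary using (Pred; Decidable)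

module _ (P : Poset 0ℓ 0ℓ 0ℓ) where
  open Poset P using (Carrier)
  open StrictOrder P using () renaming (_<_ to _≺_)

  Minimal : Carrier → Set
  Minimal x = ∀ y → ¬ y ≺ x

  -- Covers x y: y covers x.
  Covers : Carrier → Carrier → Set
  Covers x y = x ≺ y × (∀ z → ¬ (x ≺ z × z ≺ y))

record RankedPoset : Set₁ where
  field
    poset : Poset 0ℓ 0ℓ 0ℓ

  open Poset poset public using (Carrier; _≈_) renaming (_≤_ to _≼_)
  open SetoidMembership (Poset.Eq.setoid poset) public using () renaming (_∈_ to _∈≈_)
  open SetoidUnique (Poset.Eq.setoid poset) public using () renaming (Unique to Unique≈)

  field
    elements : List Carrier
    complete : ∀ x → x ∈≈ elements
    unique   : Unique≈ elements

    rank         : Carrier → ℕ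
    rank-cong    : ∀ {x y} → x ≈ y → rank x ≡ rank y
    rank-minimal : ∀ x → Minimal poset x → rank x ≡ 0
    rank-cover   : ∀ {x y} → Covers poset x y → rank y ≡ suc (rank x)

module _ (P : RankedPoset) where
  open RankedPoset P

  maxRank : ℕ
  maxRank = max 0 (List.map rank elements)

  rankSize : ℕ → ℕ
  rankSize k = length (filter (λ x → rank x ℕ.≟ k) elements)

  -- The polynomial w₀ + w₁ x + ⋯ + wᵣ xʳ as its list of coefficients
  -- w₀, …, wᵣ (so wᵣ ≠ 0 as soon as the poset is nonempty).
  rankGeneratingFunction : List ℕ
  rankGeneratingFunction = List.map rankSize (upTo (suc maxRank))

  RankSymmetric : Set
  RankSymmetric = ∀ k → k ℕ.≤ maxRank → rankSize k ≡ rankSize (maxRank ∸ k)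

  RankUnimodal : Set
  RankUnimodal = ∃ λ j → j ℕ.≤ maxRank
    × (∀ i → i ℕ.< j → rankSize i ℕ.≤ rankSize (suc i))
    × (∀ i → j ℕ.≤ i → i ℕ.< maxRank → rankSize (suc i) ℕ.≤ rankSize i)

  IsAntichain : List Carrier → Set
  IsAntichain A = ∀ x y → x ∈≈ A → y ∈≈ A → x ≼ y → x ≈ y

  -- U lists, without repetition, the union of k antichains.
  record IsUnionOfAntichains (k : ℕ) (U : List Carrier) : Set where
    field
      unique    : Unique≈ U
      antichain : Fin k → List Carrier
      isAnti    : ∀ i → IsAntichain (antichain i)
      union     : ∀ x → x ∈≈ U ⇔ ∃ λ i → x ∈≈ antichain i

  IsMaxUnionSize : ℕ → ℕ → Set
  IsMaxUnionSize k m =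
      (∃ λ U → IsUnionOfAntichains k U × length U ≡ m)
    × (∀ U → IsUnionOfAntichains k U → length U ℕ.≤ m)

  sortDescending : List ℕ → List ℕ
  sortDescending = Sort.sort (Flip.decTotalOrder ℕ.≤-decTotalOrder)

  largestRanksTotal : ℕ → ℕ
  largestRanksTotal k = sum (take k (sortDescending rankGeneratingFunction))

  StronglySperner : Set
  StronglySperner = ∀ k → 1 ℕ.≤ k → IsMaxUnionSize k (largestRanksTotal k)

-- A set partition is given by a repetition-free list of its blocks; lists
-- with the same members represent the same partition (see _≈ᴺ_ below).
record IsSetPartition {n} (bs : List (Subset n)) : Set where
  field
    unique   : Unique bs
    nonempty : ∀ {B} → B ∈ₗ bs → Nonempty B
    disjoint : ∀ {B C} → B ∈ₗ bs → C ∈ₗ bs → B ≢ C → Empty (B ∩ C)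
    covers   : ∀ x → ∃ λ B → B ∈ₗ bs × x ∈ B

Noncrossing : ∀ {n} → List (Subset n) → Set
Noncrossing bs = ∀ {B C} → B ∈ₗ bs → C ∈ₗ bs → B ≢ C →
  ∀ a b c d → a < b → b < c → c < d → ¬ (a ∈ B × c ∈ B × b ∈ C × d ∈ C)

record NoncrossingPartition (n : ℕ) : Set where
  constructor ncp
  field
    blocks         : List (Subset n)
    isSetPartition : IsSetPartition blocks
    noncrossing    : Noncrossing blocks

  open IsSetPartition isSetPartition public

open NoncrossingPartition using (blocks)

bk : ∀ {n} → NoncrossingPartition n → ℕ
bk π = length (blocks π)

_≈ᴺ_ : ∀ {n} → Rel (NoncrossingPartition n) 0ℓ
π ≈ᴺ ν = ∀ B → B ∈ₗ blocks π ⇔ B ∈ₗ blocks ν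

_≤ᴺ_ : ∀ {n} → Rel (NoncrossingPartition n) 0ℓ
π ≤ᴺ ν = ∀ B → B ∈ₗ blocks ν → ∃ λ As → All (_∈ₗ blocks π) As × B ≡ ⋃ As

Avoids132 : ∀ {n} → Permutation′ n → Set
Avoids132 p = ∀ a b c → a < b → b < c →
  ¬ (p ⟨$⟩ʳ a < p ⟨$⟩ʳ c × p ⟨$⟩ʳ c < p ⟨$⟩ʳ b)

-- Positions and values are counted from 0, so i : Fin (pred n) stands for
-- the index i + 1 ∈ [n - 1].
Des : ∀ {n} → Permutation′ n → Subset (pred n)
Des {zero}  p = []
Des {suc n} p = tabulate λ i → does (p ⟨$⟩ʳ suc i Fin.<? p ⟨$⟩ʳ inject₁ i)

record AvoidingPermutation (n : ℕ) : Set where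
  constructor avp
  field
    perm     : Permutation′ n
    avoiding : Avoids132 perm

open AvoidingPermutation using (perm)

_≈ᴾ_ : ∀ {n} → Rel (AvoidingPermutation n) 0ℓ
p ≈ᴾ q = perm p Perm.≈ perm q

_<ᴾ_ : ∀ {n} → Rel (AvoidingPermutation n) 0ℓ
p <ᴾ q = Des (perm p) ⊂ Des (perm q)

module Enumerate {A B : Set} {P : A → Set} (P? : Decidable P) (f : ∀ x → P x → B) where

  enumerate : List A → List B
  enumerate [] = []
  enumerate (x ∷ xs) with P? x
  ... | yes px = f x px ∷ enumerate xs
  ... | no  _  = enumerate xs

  enumerate-any : {Q : B → Set} → ∀ {xs} →
                  Any (λ x → P x × ∀ px → Q (f x px)) xs → Any Q (enumerate xs)
  enumerate-any {xs = x ∷ xs} (here (px , q)) with P? x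
  ... | yes px′ = here (q px′)
  ... | no  ¬px = contradiction px ¬px
  enumerate-any {xs = x ∷ xs} (there a) with P? x
  ... | yes _ = there (enumerate-any a)
  ... | no  _ = enumerate-any a

  enumerate-all : {Q : B → Set} → ∀ {xs} →
                  All (λ x → ∀ px → Q (f x px)) xs → All Q (enumerate xs)
  enumerate-all [] = []
  enumerate-all {xs = x ∷ xs} (q ∷ qs) with P? x
  ... | yes px = q px ∷ enumerate-all qs
  ... | no  _  = enumerate-all qs

  enumerate-pairs : {R : B → B → Set} → ∀ {xs} →
                    AllPairs (λ x y → ∀ px py → R (f x px) (f y py)) xs →
                    AllPairs R (enumerate xs)
  enumerate-pairs [] = []
  enumerate-pairs {xs = x ∷ xs} (r ∷ rs) with P? x
  ... | yes px = enumerate-all (All.map (λ h → h px) r) ∷ enumerate-pairs rs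
  ... | no  _  = enumerate-pairs rs

permSetoid : ℕ → Setoid 0ℓ 0ℓ
permSetoid n = record
  { Carrier = Permutation′ n
  ; _≈_ = Perm._≈_
  ; isEquivalence = record
    { refl  = λ _ → refl
    ; sym   = λ e i → sym (e i)
    ; trans = λ e f i → trans (e i) (f i)
    }
  }

avoids? : ∀ {n} → Decidable (Avoids132 {n})
avoids? p =
  (Fin.all? λ a → Fin.all? λ b → Fin.all? λ c →
    (a Fin.<? b) →-dec ((b Fin.<? c) →-dec
      ¬? ((p ⟨$⟩ʳ a Fin.<? p ⟨$⟩ʳ c) ×-dec (p ⟨$⟩ʳ c Fin.<? p ⟨$⟩ʳ b))))

Avoids132-resp : ∀ {n} {p q : Permutation′ n} → p Perm.≈ q → Avoids132 p → Avoids132 q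
Avoids132-resp e av a b c a<b b<c (u , v) rewrite sym (e a) | sym (e b) | sym (e c) =
  av a b c a<b b<c (u , v)

Des-cong : ∀ {n} {p q : Permutation′ n} → p Perm.≈ q → Des p ≡ Des q
Des-cong {zero}  e = refl
Des-cong {suc n} e = Vec.tabulate-cong λ i →
  cong₂ (λ x y → does (x Fin.<? y)) (e (suc i)) (e (inject₁ i))

insert-cong : ∀ {n i j} {p q : Permutation′ n} → p Perm.≈ q → insert i j p Perm.≈ insert i j q
insert-cong {i = i} {j} e k with i Fin.≟ k
... | yes _ = refl
... | no  _ = cong (punchIn j) (e _)

insert-injective : ∀ {n} {j k} {p q : Permutation′ n} →
                   insert zero j p Perm.≈ insert zero k q → j ≡ k × p Perm.≈ q
insert-injective {j = j} {p = p} {q} e with e zero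
... | refl = refl , λ i → Fin.punchIn-injective j _ _ (e (suc i))

permutations : ∀ n → List (Permutation′ n)
permutations zero    = Perm.id ∷ []
permutations (suc n) = cartesianProductWith (insert zero) (allFin (suc n)) (permutations n)

permutations-complete : ∀ {n} (p : Permutation′ n) →
                        SetoidMembership._∈_ (permSetoid n) p (permutations n)
permutations-complete {zero}  p = here λ ()
permutations-complete {suc n} p =
  Any.map (λ e i → trans (sym (Perm.insert-remove zero p i)) (e i))
    (SetoidMembershipₚ.∈-cartesianProductWith⁺ (setoid (Fin (suc n))) (permSetoid n) (permSetoid (suc n))
      (λ { {x} {y} {u} {v} refl e → insert-cong {i = zero} {x} {u} {v} e })
      (∈ₗ.∈-allFin (p ⟨$⟩ʳ zero)) (permutations-complete (remove zero p)))

permutations-unique : ∀ n → SetoidUnique.Unique (permSetoid n) (permutations n)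
permutations-unique zero    = [] ∷ []
permutations-unique (suc n) =
  SetoidUniqueₚ.cartesianProductWith⁺ (setoid (Fin (suc n))) (permSetoid n) (permSetoid (suc n))
    (insert zero) (λ {w} {x} {y} {z} → insert-injective {p = y} {q = z})
    (Unique.allFin⁺ (suc n)) (permutations-unique n)

<ᴾ-strictPartialOrder : ℕ → StrictPartialOrder 0ℓ 0ℓ 0ℓ
<ᴾ-strictPartialOrder n = record
  { Carrier = AvoidingPermutation n
  ; _≈_ = _≈ᴾ_
  ; _<_ = _<ᴾ_
  ; isStrictPartialOrder = record
    { isEquivalence = On.isEquivalence perm (Setoid.isEquivalence (permSetoid n))
    ; irrefl = λ {p} {q} e → Subset.⊂-irref (Des-cong {p = perm p} {q = perm q} e)
    ; trans = Subset.⊂-trans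
    ; <-resp-≈ = (λ {p} {q} {r} e → subst (Des (perm p) ⊂_) (Des-cong {p = perm q} {q = perm r} e))
               , (λ {p} {q} {r} e → subst (_⊂ Des (perm p)) (Des-cong {p = perm q} {q = perm r} e))
    }
  }

≤ᴾ-poset : ℕ → Poset 0ℓ 0ℓ 0ℓ
≤ᴾ-poset n = record
  { isPartialOrder = StrictToNonStrict.isPartialOrder _≈ᴾ_ _<ᴾ_
      (StrictPartialOrder.isStrictPartialOrder (<ᴾ-strictPartialOrder n)) }

punchIn-mono-< : ∀ {n} (v : Fin (suc n)) {x y} → x < y → punchIn v x < punchIn v y
punchIn-mono-< v {x} {y} x<y = ℕ.≰⇒> λ h → ℕ.<⇒≱ x<y (Fin.punchIn-cancel-≤ v y x h)

punchIn-cancel-< : ∀ {n} (v : Fin (suc n)) {x y} → punchIn v x < punchIn v y → x < y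
punchIn-cancel-< v {x} {y} h = ℕ.≰⇒> λ y≤x → ℕ.<⇒≱ h (Fin.punchIn-mono-≤ v y x y≤x)

does-punchIn-<? : ∀ {n} (v : Fin (suc n)) x y → does (punchIn v x Fin.<? punchIn v y) ≡ does (x Fin.<? y)
does-punchIn-<? v x y =
  does-⇔ (mk⇔ (punchIn-cancel-< v) (punchIn-mono-< v)) (punchIn v x Fin.<? punchIn v y) (x Fin.<? y)

punchIn-inject₁ : ∀ {n} (k : Fin n) → punchIn (inject₁ k) k ≡ suc k
punchIn-inject₁ zero    = refl
punchIn-inject₁ (suc k) = cong suc (punchIn-inject₁ k)

inject₁<⇒≤ : ∀ {n} (k l : Fin n) → inject₁ k < punchIn (inject₁ k) l → k ≤ l
inject₁<⇒≤ zero    l       _         = ℕ.z≤n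
inject₁<⇒≤ (suc k) (suc l) (ℕ.s≤s h) = ℕ.s≤s (inject₁<⇒≤ k l h)

-- Every subset of [n - 1] is the descent set of some 132-avoiding
-- permutation: choose the first value to be either the largest one or the
-- predecessor of the second value.
realise : ∀ n (S : Subset (pred n)) → ∃ λ (p : AvoidingPermutation n) → Des (perm p) ≡ S
realise zero          []            = avp Perm.id (λ ()) , refl
realise (suc zero)    []            = avp Perm.id (λ { zero zero _ () }) , refl
realise (suc (suc m)) (outside ∷ S) with realise (suc m) S
... | avp p av , refl = avp q av′ , cong₂ _∷_ head (Vec.tabulate-cong λ i →
  does-punchIn-<? v (p ⟨$⟩ʳ suc i) (p ⟨$⟩ʳ inject₁ i))
  where
  v = inject₁ (p ⟨$⟩ʳ zero)
  q = insert zero v p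
  head : does (punchIn v (p ⟨$⟩ʳ zero) Fin.<? v) ≡ outside
  head = dec-false (punchIn v (p ⟨$⟩ʳ zero) Fin.<? v) λ h → ℕ.<⇒≱ h (ℕ.<⇒≤
    (subst (v <_) (sym (punchIn-inject₁ (p ⟨$⟩ʳ zero))) (Fin.≤̄⇒inject₁< {i = p ⟨$⟩ʳ zero} ℕ.≤-refl)))
  av′ : Avoids132 q
  av′ (suc a) (suc b) (suc c) (ℕ.s≤s a<b) (ℕ.s≤s b<c) (h , h′) =
    av a b c a<b b<c (punchIn-cancel-< v h , punchIn-cancel-< v h′)
  av′ zero (suc zero) (suc c) _ (ℕ.s≤s b<c) (h , h′) =
    ℕ.<⇒≱ (punchIn-cancel-< v h′) (inject₁<⇒≤ (p ⟨$⟩ʳ zero) _ h)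
  av′ zero (suc (suc b)) (suc c) _ (ℕ.s≤s b<c) (h , h′) =
    av zero (suc b) c ℕ.z<s b<c
      ( Fin.≤∧≢⇒< (inject₁<⇒≤ (p ⟨$⟩ʳ zero) _ h)
          (λ e → Fin.<⇒≢ (ℕ.≤-<-trans ℕ.z≤n b<c) (Injection.injective (↔⇒↣ p) e))
      , punchIn-cancel-< v h′)
realise (suc (suc m)) (inside ∷ S) with realise (suc m) S
... | avp p av , refl = avp q av′ , cong₂ _∷_ head (Vec.tabulate-cong λ i →
  does-punchIn-<? v (p ⟨$⟩ʳ suc i) (p ⟨$⟩ʳ inject₁ i))
  where
  v = fromℕ (suc m)
  q = insert zero v p
  head : does (punchIn v (p ⟨$⟩ʳ zero) Fin.<? v) ≡ inside
  head = dec-true (punchIn v (p ⟨$⟩ʳ zero) Fin.<? v) (Fin.≤∧≢⇒< (Fin.≤fromℕ _) (Fin.punchInᵢ≢i v _))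
  av′ : Avoids132 q
  av′ (suc a) (suc b) (suc c) (ℕ.s≤s a<b) (ℕ.s≤s b<c) (h , h′) =
    av a b c a<b b<c (punchIn-cancel-< v h , punchIn-cancel-< v h′)
  av′ zero (suc b) (suc c) _ _ (h , _) = ℕ.<⇒≱ h (Fin.≤fromℕ _)

∣p∪⁅x⁆∣ : ∀ {n} (p : Subset n) x → x ∉ p → ∣ p ∪ ⁅ x ⁆ ∣ ≡ suc ∣ p ∣
∣p∪⁅x⁆∣ (inside  ∷ p) zero    x∉ = contradiction here x∉
∣p∪⁅x⁆∣ (outside ∷ p) zero    x∉ = cong (suc ∘ ∣_∣) (Subset.∪-identityʳ p)
∣p∪⁅x⁆∣ (inside  ∷ p) (suc x) x∉ = cong suc (∣p∪⁅x⁆∣ p x (x∉ ∘ there))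
∣p∪⁅x⁆∣ (outside ∷ p) (suc x) x∉ = ∣p∪⁅x⁆∣ p x (x∉ ∘ there)

module _ {n : ℕ} where
  open StrictOrder (≤ᴾ-poset n) using () renaming (_<_ to _≺_)

  ⊂⇒≺ : ∀ {p q : AvoidingPermutation n} → p <ᴾ q → p ≺ q
  ⊂⇒≺ {p} {q} p<q = inj₁ p<q , λ e → StrictPartialOrder.irrefl (<ᴾ-strictPartialOrder n) {p} {q} e p<q

  rankᴾ-minimal : ∀ p → Minimal (≤ᴾ-poset n) p → ∣ Des (perm p) ∣ ≡ 0
  rankᴾ-minimal p min with Subset.nonempty? (Des (perm p))
  ... | no empty = trans (cong ∣_∣ (Subset.Empty-unique empty)) (Subset.∣⊥∣≡0 (pred n))
  ... | yes (x , x∈) with realise n ⊥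
  ...   | q , e = contradiction (⊂⇒≺ {q} {p} (subst (_⊂ Des (perm p)) (sym e)
                    ((λ y∈ → contradiction y∈ Subset.∉⊥) , x , x∈ , Subset.∉⊥))) (min q)

  rankᴾ-cover : ∀ p q → Covers (≤ᴾ-poset n) p q → ∣ Des (perm q) ∣ ≡ suc ∣ Des (perm p) ∣
  rankᴾ-cover p q ((inj₂ p≈q , p≉q) , _) = contradiction p≈q p≉q
  rankᴾ-cover p q ((inj₁ (p⊆q , x , x∈q , x∉p) , _) , none) with realise n (Des (perm p) ∪ ⁅ x ⁆)
  ... | r , e = trans (cong ∣_∣ (Subset.⊆-antisym q⊆T T⊆q)) (∣p∪⁅x⁆∣ _ x x∉p)
    where
    T = Des (perm p) ∪ ⁅ x ⁆
    T⊆q : T ⊆ Des (perm q)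
    T⊆q y∈ with Subset.x∈p∪q⁻ (Des (perm p)) ⁅ x ⁆ y∈
    ... | inj₁ y∈p = p⊆q y∈p
    ... | inj₂ y∈x with Subset.x∈⁅y⁆⇒x≡y x y∈x
    ...   | refl = x∈q
    p⊂T : Des (perm p) ⊂ T
    p⊂T = Subset.p⊆p∪q ⁅ x ⁆ , x , Subset.x∈p∪q⁺ (inj₂ (Subset.x∈⁅x⁆ x)) , x∉p
    q⊆T : Des (perm q) ⊆ T
    q⊆T {y} y∈ with y Subset.∈? T
    ... | yes y∈T = y∈T
    ... | no  y∉T = contradiction
      ( ⊂⇒≺ {p} {r} (subst (Des (perm p) ⊂_) (sym e) p⊂T)
      , ⊂⇒≺ {r} {q} (subst (_⊂ Des (perm q)) (sym e) (T⊆q , y , y∈ , y∉T))) (none r)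

Pᴬ : ℕ → RankedPoset
Pᴬ n = record
  { poset = ≤ᴾ-poset n
  ; rank = λ p → ∣ Des (perm p) ∣
  ; rank-cong = λ {p} {q} e → cong ∣_∣ (Des-cong {p = perm p} {q = perm q} e)
  ; rank-minimal = rankᴾ-minimal
  ; rank-cover = λ {p} {q} → rankᴾ-cover p q
  ; elements = enumerate (permutations n)
  ; complete = λ (avp p av) → enumerate-any
      (Any.map (λ {q} e → Avoids132-resp {p = p} {q = q} e av , λ _ → e) (permutations-complete p))
  ; unique = enumerate-pairs (AllPairs.map (λ p≉q _ _ → p≉q) (permutations-unique n))
  }
  where open Enumerate (avoids? {n}) avp

module _ {n : ℕ} where

  _≟ˢ_ : (B C : Subset n) → Dec (B ≡ C)
  _≟ˢ_ = Vec.≡-dec Bool._≟_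

  x∈⋃⁻ : ∀ {x : Fin n} As → x ∈ ⋃ As → ∃ λ A → A ∈ₗ As × x ∈ A
  x∈⋃⁻ []       x∈ = contradiction x∈ Subset.∉⊥
  x∈⋃⁻ (A ∷ As) x∈ with Subset.x∈p∪q⁻ A (⋃ As) x∈
  ... | inj₁ x∈A = A , here refl , x∈A
  ... | inj₂ x∈⋃ with x∈⋃⁻ As x∈⋃
  ...   | C , C∈ , x∈C = C , there C∈ , x∈C

  x∈⋃⁺ : ∀ {x : Fin n} {A As} → A ∈ₗ As → x ∈ A → x ∈ ⋃ As
  x∈⋃⁺ {As = C ∷ As} (here refl) x∈ = Subset.x∈p∪q⁺ (inj₁ x∈)
  x∈⋃⁺ {As = C ∷ As} (there A∈)  x∈ = Subset.x∈p∪q⁺ {p = C} (inj₂ (x∈⋃⁺ A∈ x∈))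

  ⋃-trans : ∀ {P : Pred (Subset n) 0ℓ} Bs →
            All (λ B → ∃ λ As → All P As × B ≡ ⋃ As) Bs → ∃ λ As → All P As × ⋃ Bs ≡ ⋃ As
  ⋃-trans []       []                     = [] , [] , refl
  ⋃-trans (B ∷ Bs) ((As , pAs , refl) ∷ r) with ⋃-trans Bs r
  ... | Cs , pCs , e = As ++ Cs , All.++⁺ pAs pCs , trans (cong (⋃ As ∪_) e) (sym (⋃-++ As Cs))
    where
    ⋃-++ : ∀ As Cs → ⋃ (As ++ Cs) ≡ ⋃ As ∪ ⋃ Cs
    ⋃-++ []       Cs = sym (Subset.∪-identityˡ (⋃ Cs))
    ⋃-++ (A ∷ As) Cs = trans (cong (A ∪_) (⋃-++ As Cs)) (sym (Subset.∪-assoc A (⋃ As) (⋃ Cs)))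

  same-block : ∀ {bs : List (Subset n)} → IsSetPartition bs → ∀ {B C x} →
               B ∈ₗ bs → C ∈ₗ bs → x ∈ B → x ∈ C → B ≡ C
  same-block isP {B} {C} B∈ C∈ x∈B x∈C with B ≟ˢ C
  ... | yes B≡C = B≡C
  ... | no  B≢C = contradiction (_ , Subset.x∈p∩q⁺ (x∈B , x∈C)) (IsSetPartition.disjoint isP B∈ C∈ B≢C)

  module _ {π ν : NoncrossingPartition n} where
    open NoncrossingPartition

    below : π ≤ᴺ ν → ∀ {A} → A ∈ₗ blocks π → ∃ λ B → B ∈ₗ blocks ν × A ⊆ B
    below π≤ν A∈ with nonempty π A∈
    ... | x , x∈A with covers ν x
    ...   | B , B∈ , x∈B with π≤ν B B∈
    ...     | As , As∈ , refl with x∈⋃⁻ As x∈B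
    ...       | A′ , A′∈ , x∈A′ with same-block (isSetPartition π) A∈ (All.lookup As∈ A′∈) x∈A x∈A′
    ...         | refl = B , B∈ , λ y∈ → x∈⋃⁺ A′∈ y∈

  half-antisym : ∀ {π ν : NoncrossingPartition n} → π ≤ᴺ ν → ν ≤ᴺ π →
                 ∀ {A} → A ∈ₗ blocks π → A ∈ₗ blocks ν
  half-antisym {π} {ν} π≤ν ν≤π A∈ with below {π} {ν} π≤ν A∈
  ... | B , B∈ , A⊆B with below {ν} {π} ν≤π B∈ | NoncrossingPartition.nonempty π A∈
  ...   | A′ , A′∈ , B⊆A′ | x , x∈A
          with same-block (NoncrossingPartition.isSetPartition π) A∈ A′∈ x∈A (B⊆A′ (A⊆B x∈A))
  ...     | refl = subst (_∈ₗ blocks ν) (Subset.⊆-antisym B⊆A′ A⊆B) B∈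

  isNCP? : Decidable {A = List (Subset n)} (λ bs → IsSetPartition bs × Noncrossing bs)
  isNCP? bs = map′ to from
    (unique? bs ×-dec (All.all? Subset.nonempty? bs ×-dec (disjoint? ×-dec (covers? ×-dec noncrossing?))))
    where
    open import Data.List.Relation.Unary.Unique.DecPropositional _≟ˢ_ using (unique?)
    disjoint? = All.all? (λ B → All.all? (λ C → ¬? (B ≟ˢ C) →-dec ¬? (Subset.nonempty? (B ∩ C))) bs) bs
    covers? = Fin.all? λ x → Any.any? (λ B → x Subset.∈? B) bs
    noncrossing? = All.all? (λ B → All.all? (λ C → ¬? (B ≟ˢ C) →-dec
      (Fin.all? λ a → Fin.all? λ b → Fin.all? λ c → Fin.all? λ d →
        (a Fin.<? b) →-dec ((b Fin.<? c) →-dec ((c Fin.<? d) →-dec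
          ¬? ((a Subset.∈? B) ×-dec ((c Subset.∈? B) ×-dec ((b Subset.∈? C) ×-dec (d Subset.∈? C)))))))) bs) bs
    to : _ → _
    to (u , ne , di , co , nc) =
      record
        { unique   = u
        ; nonempty = All.lookup ne
        ; disjoint = λ B∈ C∈ → All.lookup (All.lookup di B∈) C∈
        ; covers   = λ x → find (co x)
        } , λ B∈ C∈ → All.lookup (All.lookup nc B∈) C∈
    from : _ → _
    from (isP , nc) = unique , All.tabulate nonempty
      , All.tabulate (λ B∈ → All.tabulate (λ C∈ → disjoint B∈ C∈))
      , (λ x → let B , B∈ , x∈B = covers x in lose B∈ x∈B)
      , All.tabulate (λ B∈ → All.tabulate (λ C∈ → nc B∈ C∈))
      where open IsSetPartition isP

sides : List Side
sides = outside ∷ inside ∷ []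

subsets : ∀ n → List (Subset n)
subsets zero    = [] ∷ []
subsets (suc n) = cartesianProductWith _∷_ sides (subsets n)

subsets-complete : ∀ {n} (B : Subset n) → B ∈ₗ subsets n
subsets-complete []            = here refl
subsets-complete (outside ∷ B) = ∈ₗ.∈-cartesianProductWith⁺ _∷_ {xs = sides} (here refl) (subsets-complete B)
subsets-complete (inside  ∷ B) = ∈ₗ.∈-cartesianProductWith⁺ _∷_ {xs = sides} (there (here refl)) (subsets-complete B)

subsets-unique : ∀ n → Unique (subsets n)
subsets-unique zero    = [] ∷ []
subsets-unique (suc n) = Unique.cartesianProductWith⁺ _∷_ Vec.∷-injective
  (((λ ()) ∷ []) ∷ [] ∷ []) (subsets-unique n)

module _ {A : Set} where

  sublists : List A → List (List A)
  sublists []       = [] ∷ []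
  sublists (x ∷ xs) = List.map (x ∷_) (sublists xs) ++ sublists xs

  filter∈sublists : {P : Pred A 0ℓ} (P? : Decidable P) → ∀ xs → filter P? xs ∈ₗ sublists xs
  filter∈sublists P? [] = here refl
  filter∈sublists P? (x ∷ xs) with does (P? x)
  ... | true  = ∈ₗ.∈-++⁺ˡ (∈ₗ.∈-map⁺ (x ∷_) (filter∈sublists P? xs))
  ... | false = ∈ₗ.∈-++⁺ʳ _ (filter∈sublists P? xs)

  Distinguished : List A → List A → List A → Set
  Distinguished xs ss ts = ∃ λ y → y ∈ₗ xs × ((y ∈ₗ ss × ¬ y ∈ₗ ts) ⊎ (¬ y ∈ₗ ss × y ∈ₗ ts))

  sublists-⊆ : ∀ xs → All (All (_∈ₗ xs)) (sublists xs)
  sublists-⊆ []       = [] ∷ []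
  sublists-⊆ (x ∷ xs) = All.++⁺
    (All.map⁺ (All.map (λ h → here refl ∷ All.map there h) (sublists-⊆ xs)))
    (All.map (All.map there) (sublists-⊆ xs))

  sublists-distinct : ∀ xs → Unique xs → AllPairs (Distinguished xs) (sublists xs)
  sublists-distinct []       _          = [] ∷ []
  sublists-distinct (x ∷ xs) (x∉ ∷ xs!) = AllPairs.++⁺
    (AllPairs.map⁺ (AllPairs.map cons ih))
    (AllPairs.map (λ (y , y∈ , h) → y , there y∈ , h) ih)
    (All.map⁺ (All.universal (λ ss → All.map (λ h → x , here refl ,
      inj₁ (here refl , λ x∈ → All.lookup x∉ (All.lookup h x∈) refl)) (sublists-⊆ xs)) _))
    where
    ih = sublists-distinct xs xs!
    skip : ∀ {y ts} → y ∈ₗ xs → ¬ y ∈ₗ ts → ¬ y ∈ₗ x ∷ ts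
    skip y∈ y∉ (here refl) = All.lookup x∉ y∈ refl
    skip y∈ y∉ (there y∈′) = y∉ y∈′
    cons : ∀ {ss ts} → Distinguished xs ss ts → Distinguished (x ∷ xs) (x ∷ ss) (x ∷ ts)
    cons (y , y∈ , inj₁ (a , b)) = y , there y∈ , inj₁ (there a , skip y∈ b)
    cons (y , y∈ , inj₂ (a , b)) = y , there y∈ , inj₂ (skip y∈ a , there b)

  distinguished⇒≁ : ∀ {xs ss ts} → Distinguished xs ss ts → ¬ ss ∼[ set ] ts
  distinguished⇒≁ (y , _ , inj₁ (y∈ , y∉)) e = y∉ (Equivalence.to e y∈)
  distinguished⇒≁ (y , _ , inj₂ (y∉ , y∈)) e = y∉ (Equivalence.from e y∈)

module _ {n : ℕ} where
  open import Data.List.Membership.DecPropositional (_≟ˢ_ {n}) using (_∈?_)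

  canonical : (bs : List (Subset n)) → Any (λ cs → Unique cs × bs ∼[ set ] cs) (sublists (subsets n))
  canonical bs = lose (filter∈sublists (_∈? bs) (subsets n))
    ( Unique.filter⁺ (_∈? bs) (subsets-unique n)
    , mk⇔ (λ B∈ → ∈ₗ.∈-filter⁺ (_∈? bs) (subsets-complete _) B∈)
          (λ B∈ → proj₂ (∈ₗ.∈-filter⁻ (_∈? bs) {xs = subsets n} B∈)))

  isNCP-resp : ∀ {bs cs : List (Subset n)} → Unique cs → bs ∼[ set ] cs →
               IsSetPartition bs × Noncrossing bs → IsSetPartition cs × Noncrossing cs
  isNCP-resp cs! e (isP , nc) =
    record
      { unique   = cs!
      ; nonempty = λ B∈ → nonempty (from B∈)
      ; disjoint = λ B∈ C∈ → disjoint (from B∈) (from C∈)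
      ; covers   = λ x → let B , B∈ , x∈B = covers x in B , Equivalence.to e B∈ , x∈B
      } , λ B∈ C∈ → nc (from B∈) (from C∈)
    where
    open IsSetPartition isP
    from : ∀ {B} → _ → B ∈ₗ _
    from {B} = Equivalence.from (e {B})

≤ᴺ-poset : ℕ → Poset 0ℓ 0ℓ 0ℓ
≤ᴺ-poset n = record
  { Carrier = NoncrossingPartition n
  ; _≈_ = _≈ᴺ_
  ; _≤_ = _≤ᴺ_
  ; isPartialOrder = record
    { isPreorder = record
      { isEquivalence = record
        { refl  = λ B → ⇔-id _
        ; sym   = λ e B → ⇔-sym (e B)
        ; trans = λ e f B → f B ⇔-∘ e B
        }
      ; reflexive = λ π≈ν B B∈ →
          B ∷ [] , Equivalence.from (π≈ν B) B∈ ∷ [] , sym (Subset.∪-identityʳ B)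
      ; trans = λ π≤ν ν≤τ B B∈ → let Bs , Bs∈ , B≡ = ν≤τ B B∈
                                     As , As∈ , e  = ⋃-trans Bs (All.map (π≤ν _) Bs∈)
                                 in As , As∈ , trans B≡ e
      }
    ; antisym = λ {π} {ν} π≤ν ν≤π →
        λ B → mk⇔ (half-antisym {π = π} {ν} π≤ν ν≤π) (half-antisym {π = ν} {π} ν≤π π≤ν)
    }
  }

bk-cong : ∀ {n} {π ν : NoncrossingPartition n} → π ≈ᴺ ν → bk π ≡ bk ν
bk-cong {π = π} {ν} π≈ν = ↭-length (∼bag⇒↭
  (unique∧set⇒bag (NoncrossingPartition.unique π) (NoncrossingPartition.unique ν) λ {B} → π≈ν B))

least : ∀ {n} {p : Subset n} → Nonempty p → ∃ λ m → m ∈ p × ∀ {y} → y ∈ p → m ≤ y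
least {p = inside  ∷ p} _                = zero , here , λ _ → ℕ.z≤n
least {p = outside ∷ p} (suc x , there x∈) with least (x , x∈)
... | m , m∈ , m≤ = suc m , there m∈ , λ { (there y∈) → ℕ.s≤s (m≤ y∈) }

lookup-injective : ∀ {A : Set} {xs : List A} → Unique xs → ∀ {i j} → lookup xs i ≡ lookup xs j → i ≡ j
lookup-injective (x∉ ∷ xs!) {zero}  {zero}  e = refl
lookup-injective (x∉ ∷ xs!) {zero}  {suc j} e = contradiction e (All.lookup x∉ (∈ₗ.∈-lookup j))
lookup-injective (x∉ ∷ xs!) {suc i} {zero}  e = contradiction (sym e) (All.lookup x∉ (∈ₗ.∈-lookup i))
lookup-injective (x∉ ∷ xs!) {suc i} {suc j} e = cong suc (lookup-injective xs! e)

bk≤n : ∀ {n} (π : NoncrossingPartition n) → bk π ℕ.≤ n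
bk≤n {n} π = Fin.injective⇒≤ {f = λ i → proj₁ (nonempty (∈ₗ.∈-lookup i))} λ {i} {j} e →
  lookup-injective unique (same-block isSetPartition (∈ₗ.∈-lookup i) (∈ₗ.∈-lookup j)
    (proj₂ (nonempty (∈ₗ.∈-lookup i)))
    (subst (_∈ lookup (blocks π) j) (sym e) (proj₂ (nonempty (∈ₗ.∈-lookup j)))))
  where open NoncrossingPartition π hiding (blocks)

refines : ∀ {n} (π ν : NoncrossingPartition n) →
          (∀ {A} → A ∈ₗ blocks π → ∃ λ B → B ∈ₗ blocks ν × A ⊆ B) → π ≤ᴺ ν
refines {n} π ν h B B∈ = As , All.tabulate (λ A∈ → proj₁ (∈ₗ.∈-filter⁻ (Subset._⊆? B) {xs = blocks π} A∈))
                       , Subset.⊆-antisym B⊆ ⊆B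
  where
  open NoncrossingPartition
  As = filter (Subset._⊆? B) (blocks π)
  B⊆ : B ⊆ ⋃ As
  B⊆ {x} x∈B with covers π x
  ... | A , A∈ , x∈A with h A∈
  ...   | C , C∈ , A⊆C with same-block (isSetPartition ν) C∈ B∈ (A⊆C x∈A) x∈B
  ...     | refl = x∈⋃⁺ (∈ₗ.∈-filter⁺ (Subset._⊆? B) A∈ A⊆C) x∈A
  ⊆B : ⋃ As ⊆ B
  ⊆B x∈ with x∈⋃⁻ As x∈
  ... | A , A∈ , x∈A = proj₂ (∈ₗ.∈-filter⁻ (Subset._⊆? B) {xs = blocks π} A∈) x∈A

finest : ∀ n → NoncrossingPartition n
finest n = ncp singletons
  record
    { unique   = Unique.map⁺ (λ {x} {y} e → Subset.x∈⁅y⁆⇒x≡y y (subst (x ∈_) e (Subset.x∈⁅x⁆ x)))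
                   (Unique.allFin⁺ n)
    ; nonempty = ne
    ; disjoint = di
    ; covers   = λ x → ⁅ x ⁆ , ∈ₗ.∈-map⁺ ⁅_⁆ (∈ₗ.∈-allFin x) , Subset.x∈⁅x⁆ x
    }
  λ B∈ _ _ a b c d a<b b<c c<d (a∈B , c∈B , _) →
    Fin.<⇒≢ (ℕ.<-trans a<b b<c) (one B∈ a∈B c∈B)
  where
  singletons = List.map ⁅_⁆ (allFin n)
  ne : ∀ {B} → B ∈ₗ singletons → Nonempty B
  ne B∈ with ∈ₗ.∈-map⁻ ⁅_⁆ B∈
  ... | x , _ , refl = x , Subset.x∈⁅x⁆ x
  one : ∀ {B x y} → B ∈ₗ singletons → x ∈ B → y ∈ B → x ≡ y
  one B∈ x∈ y∈ with ∈ₗ.∈-map⁻ ⁅_⁆ B∈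
  ... | z , _ , refl = trans (Subset.x∈⁅y⁆⇒x≡y z x∈) (sym (Subset.x∈⁅y⁆⇒x≡y z y∈))
  di : ∀ {B C} → B ∈ₗ singletons → C ∈ₗ singletons → B ≢ C → Empty (B ∩ C)
  di B∈ C∈ B≢C (x , x∈) with ∈ₗ.∈-map⁻ ⁅_⁆ B∈ | ∈ₗ.∈-map⁻ ⁅_⁆ C∈
  ... | y , _ , refl | z , _ , refl with Subset.x∈p∩q⁻ ⁅ y ⁆ ⁅ z ⁆ x∈
  ...   | x∈y , x∈z = B≢C (cong ⁅_⁆
            (trans (sym (Subset.x∈⁅y⁆⇒x≡y y x∈y)) (Subset.x∈⁅y⁆⇒x≡y z x∈z)))

bk-finest : ∀ n → bk (finest n) ≡ n
bk-finest n = trans (length-map ⁅_⁆ (allFin n)) (length-tabulate {n = n} (λ i → i))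

finest-least : ∀ {n} (π : NoncrossingPartition n) → finest n ≤ᴺ π
finest-least {n} π = refines (finest n) π below-block
  where
  below-block : ∀ {A} → A ∈ₗ blocks (finest n) → ∃ λ B → B ∈ₗ blocks π × A ⊆ B
  below-block A∈ with ∈ₗ.∈-map⁻ ⁅_⁆ A∈
  ... | x , _ , refl with NoncrossingPartition.covers π x
  ...   | B , B∈ , x∈B = B , B∈ , λ y∈ → subst (_∈ B) (sym (Subset.x∈⁅y⁆⇒x≡y x y∈)) x∈B

rankᴺ-minimal : ∀ {n} (π : NoncrossingPartition n) → Minimal (≤ᴺ-poset n) π → n ∸ bk π ≡ 0
rankᴺ-minimal {n} π min with n ℕ.≟ bk π
... | yes e = trans (cong (n ∸_) (sym e)) (ℕ.n∸n≡0 n)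
... | no ne = contradiction
  (finest-least π , λ e → ne (trans (sym (bk-finest n)) (bk-cong {π = finest n} {π} e))) (min (finest n))

module _ {n : ℕ} where
  remove-block : Subset n → List (Subset n) → List (Subset n)
  remove-block A = filter (λ C → ¬? (C ≟ˢ A))

  length-remove : ∀ {A bs} → Unique bs → A ∈ₗ bs → suc (length (remove-block A bs)) ≡ length bs
  length-remove {A} {B ∷ bs} (B∉ ∷ bs!) A∈ with B ≟ˢ A | A∈
  ... | yes refl | _          = cong (suc ∘ length)
          (filter-all (λ C → ¬? (C ≟ˢ A)) (All.map (λ B≢C C≡B → B≢C (sym C≡B)) B∉))
  ... | no  B≢A  | here A≡B   = contradiction (sym A≡B) B≢A
  ... | no  _    | there A∈bs = cong suc (length-remove bs! A∈bs)

  -- If π < ν, take a block V of ν that is not a block of π.  Merging the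
  -- block A of π containing m = min V with the block B of π containing
  -- x = min (V ∖ A) gives a noncrossing τ with π < τ ≤ ν.
  module Merge (π ν : NoncrossingPartition n) (π≤ν : π ≤ᴺ ν)
               {V} (V∈ν : V ∈ₗ blocks ν) (V∉π : ¬ V ∈ₗ blocks π) where
    private
      module π = NoncrossingPartition π
      module ν = NoncrossingPartition ν

    ⊆V : ∀ {C y} → C ∈ₗ π.blocks → y ∈ C → y ∈ V → C ⊆ V
    ⊆V C∈ y∈C y∈V with below {π = π} {ν} π≤ν C∈
    ... | W , W∈ , C⊆W with same-block ν.isSetPartition W∈ V∈ν (C⊆W y∈C) y∈V
    ...   | refl = C⊆W

    minV = least (ν.nonempty V∈ν)
    m = proj₁ minV
    A = proj₁ (π.covers m)

    A∈ : A ∈ₗ π.blocks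
    A∈ = proj₁ (proj₂ (π.covers m))

    m∈A : m ∈ A
    m∈A = proj₂ (proj₂ (π.covers m))

    A⊆V : A ⊆ V
    A⊆V = ⊆V A∈ m∈A (proj₁ (proj₂ minV))

    V─A : Nonempty (V ─ A)
    V─A with Subset.nonempty? (V ─ A)
    ... | yes ne = ne
    ... | no  e  = contradiction (subst (_∈ₗ π.blocks) (Subset.⊆-antisym A⊆V V⊆A) A∈) V∉π
      where
      V⊆A : V ⊆ A
      V⊆A {y} y∈V with y Subset.∈? A
      ... | yes y∈A = y∈A
      ... | no  y∉A = contradiction (y , Subset.x∈p∧x∉q⇒x∈p─q y∈V y∉A) e

    minV─A = least V─A
    x = proj₁ minV─A
    B = proj₁ (π.covers x)

    x∈V : x ∈ V
    x∈V = Subset.p─q⊆p V A (proj₁ (proj₂ minV─A))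

    x∉A : x ∉ A
    x∉A x∈A = ─-∉ V A (proj₁ (proj₂ minV─A)) x∈A
      where
      ─-∉ : ∀ {k} {y : Fin k} p q → y ∈ p ─ q → y ∉ q
      ─-∉ (_ ∷ p) (inside  ∷ q) (there y∈) (there y∈q) = ─-∉ p q y∈ y∈q
      ─-∉ (_ ∷ p) (outside ∷ q) (there y∈) (there y∈q) = ─-∉ p q y∈ y∈q

    B∈ : B ∈ₗ π.blocks
    B∈ = proj₁ (proj₂ (π.covers x))

    x∈B : x ∈ B
    x∈B = proj₂ (proj₂ (π.covers x))

    B⊆V : B ⊆ V
    B⊆V = ⊆V B∈ x∈B x∈V

    B≢A : B ≢ A
    B≢A B≡A = x∉A (subst (x ∈_) B≡A x∈B)

    A∪B⊆V : A ∪ B ⊆ V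
    A∪B⊆V y∈ with Subset.x∈p∪q⁻ A B y∈
    ... | inj₁ y∈A = A⊆V y∈A
    ... | inj₂ y∈B = B⊆V y∈B

    A∪B∉ : ¬ (A ∪ B) ∈ₗ π.blocks
    A∪B∉ h with same-block π.isSetPartition h A∈ (Subset.x∈p∪q⁺ (inj₁ m∈A)) m∈A
    ... | e = x∉A (subst (x ∈_) e (Subset.x∈p∪q⁺ {p = A} (inj₂ x∈B)))

    rest = remove-block A (remove-block B π.blocks)

    rest⁻ : ∀ {C} → C ∈ₗ rest → C ∈ₗ π.blocks × C ≢ A × C ≢ B
    rest⁻ C∈ with ∈ₗ.∈-filter⁻ (λ C → ¬? (C ≟ˢ A)) {xs = remove-block B π.blocks} C∈
    ... | C∈′ , C≢A with ∈ₗ.∈-filter⁻ (λ C → ¬? (C ≟ˢ B)) {xs = π.blocks} C∈′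
    ...   | C∈π , C≢B = C∈π , C≢A , C≢B

    rest⁺ : ∀ {C} → C ∈ₗ π.blocks → C ≢ A → C ≢ B → C ∈ₗ rest
    rest⁺ C∈ C≢A C≢B = ∈ₗ.∈-filter⁺ (λ C → ¬? (C ≟ˢ A))
      (∈ₗ.∈-filter⁺ (λ C → ¬? (C ≟ˢ B)) C∈ C≢B) C≢A

    rest-disjoint : ∀ {C y} → C ∈ₗ rest → y ∈ C → y ∉ A ∪ B
    rest-disjoint C∈ y∈C y∈ with rest⁻ C∈ | Subset.x∈p∪q⁻ A B y∈
    ... | C∈π , C≢A , _ | inj₁ y∈A = C≢A (same-block π.isSetPartition C∈π A∈ y∈C y∈A)
    ... | C∈π , _ , C≢B | inj₂ y∈B = C≢B (same-block π.isSetPartition C∈π B∈ y∈C y∈B)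

    not-between : ∀ {C y z w} → C ∈ₗ rest → C ⊆ V → y ∈ C → w ∈ C → z ∈ A ∪ B → y < z → z < w → Empty.⊥
    not-between {C} {y} {z} {w} C∈ C⊆V y∈C w∈C z∈ y<z z<w with Subset.x∈p∪q⁻ A B z∈ | rest⁻ C∈
    ... | inj₁ z∈A | C∈π , C≢A , _ =
      π.noncrossing A∈ C∈π (C≢A ∘ sym) m y z w m<y y<z z<w (m∈A , z∈A , y∈C , w∈C)
      where
      m<y : m < y
      m<y = Fin.≤∧≢⇒< (proj₂ (proj₂ minV) (C⊆V y∈C))
        λ { refl → rest-disjoint C∈ y∈C (Subset.x∈p∪q⁺ (inj₁ m∈A)) }
    ... | inj₂ z∈B | C∈π , _ , C≢B =
      π.noncrossing B∈ C∈π (C≢B ∘ sym) x y z w x<y y<z z<w (x∈B , z∈B , y∈C , w∈C)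
      where
      x<y : x < y
      x<y = Fin.≤∧≢⇒<
        (proj₂ (proj₂ minV─A) (Subset.x∈p∧x∉q⇒x∈p─q (C⊆V y∈C)
          λ y∈A → rest-disjoint C∈ y∈C (Subset.x∈p∪q⁺ (inj₁ y∈A))))
        λ { refl → rest-disjoint C∈ y∈C (Subset.x∈p∪q⁺ {p = A} (inj₂ x∈B)) }

    τ-blocks : List (Subset n)
    τ-blocks = A ∪ B ∷ rest

    τ-disjoint : ∀ {C D} → C ∈ₗ τ-blocks → D ∈ₗ τ-blocks → C ≢ D → Empty (C ∩ D)
    τ-disjoint {C} {D} C∈ D∈ C≢D (y , y∈) with Subset.x∈p∩q⁻ C D y∈ | C∈ | D∈
    ... | _         | here refl | here refl = C≢D refl
    ... | y∈C , y∈D | here refl | there D∈′ = rest-disjoint D∈′ y∈D y∈C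
    ... | y∈C , y∈D | there C∈′ | here refl = rest-disjoint C∈′ y∈C y∈D
    ... | _         | there C∈′ | there D∈′ =
      π.disjoint (proj₁ (rest⁻ C∈′)) (proj₁ (rest⁻ D∈′)) C≢D (y , y∈)

    above : ∀ {C} → C ∈ₗ π.blocks → ∃ λ D → D ∈ₗ τ-blocks × C ⊆ D
    above {C} C∈ with C ≟ˢ A | C ≟ˢ B
    ... | yes refl | _        = A ∪ B , here refl , Subset.p⊆p∪q B
    ... | no _     | yes refl = A ∪ B , here refl , Subset.q⊆p∪q A B
    ... | no C≢A   | no C≢B   = C , there (rest⁺ C∈ C≢A C≢B) , λ y∈ → y∈

    τ-noncrossing : Noncrossing τ-blocks
    τ-noncrossing (here refl) (here refl) C≢D = contradiction refl C≢D
    τ-noncrossing (there C∈) (there D∈) C≢D = π.noncrossing (proj₁ (rest⁻ C∈)) (proj₁ (rest⁻ D∈)) C≢D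
    τ-noncrossing (here refl) (there D∈) _ a b c d a<b b<c c<d (a∈ , c∈ , b∈D , d∈D)
      with below {π = π} {ν} π≤ν (proj₁ (rest⁻ D∈))
    ... | W , W∈ , D⊆W with V ≟ˢ W
    ...   | yes refl = not-between D∈ D⊆W b∈D d∈D c∈ b<c c<d
    ...   | no  V≢W  = ν.noncrossing V∈ν W∈ V≢W a b c d a<b b<c c<d
                         (A∪B⊆V a∈ , A∪B⊆V c∈ , D⊆W b∈D , D⊆W d∈D)
    τ-noncrossing (there C∈) (here refl) _ a b c d a<b b<c c<d (a∈C , c∈C , b∈ , d∈)
      with below {π = π} {ν} π≤ν (proj₁ (rest⁻ C∈))
    ... | W , W∈ , C⊆W with W ≟ˢ V
    ...   | yes refl = not-between C∈ C⊆W a∈C c∈C b∈ a<b b<c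
    ...   | no  W≢V  = ν.noncrossing W∈ V∈ν W≢V a b c d a<b b<c c<d
                         (C⊆W a∈C , C⊆W c∈C , A∪B⊆V b∈ , A∪B⊆V d∈)

    τ : NoncrossingPartition n
    τ = ncp τ-blocks
      record
        { unique   = All.tabulate (λ C∈ A∪B≡C → A∪B∉ (subst (_∈ₗ π.blocks) (sym A∪B≡C) (proj₁ (rest⁻ C∈))))
                   ∷ Unique.filter⁺ _ (Unique.filter⁺ _ π.unique)
        ; nonempty = λ { (here refl) → m , Subset.x∈p∪q⁺ (inj₁ m∈A)
                       ; (there C∈)  → π.nonempty (proj₁ (rest⁻ C∈)) }
        ; disjoint = τ-disjoint
        ; covers   = λ y → let C , C∈ , y∈C = π.covers y ; D , D∈ , C⊆D = above C∈
                           in D , D∈ , C⊆D y∈C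
        }
      τ-noncrossing

    π≤τ : π ≤ᴺ τ
    π≤τ = refines π τ above

    π≉τ : ¬ π ≈ᴺ τ
    π≉τ e = A∪B∉ (Equivalence.from (e (A ∪ B)) (here refl))

    τ≤ν : τ ≤ᴺ ν
    τ≤ν = refines τ ν λ { (here refl) → V , V∈ν , A∪B⊆V
                        ; (there C∈)  → below {π = π} {ν} π≤ν (proj₁ (rest⁻ C∈)) }

    bk-τ : bk π ≡ suc (bk τ)
    bk-τ = sym (trans (cong suc (length-remove (Unique.filter⁺ _ π.unique)
                 (∈ₗ.∈-filter⁺ (λ C → ¬? (C ≟ˢ B)) A∈ (B≢A ∘ sym))))
               (length-remove π.unique B∈))

  rankᴺ-cover : ∀ π ν → Covers (≤ᴺ-poset n) π ν → n ∸ bk ν ≡ suc (n ∸ bk π)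
  rankᴺ-cover π ν ((π≤ν , π≉ν) , none) with All.all? (_∈? blocks π) (blocks ν)
    where open import Data.List.Membership.DecPropositional (_≟ˢ_ {n}) using (_∈?_)
  ... | yes ν⊆π = contradiction (λ C → mk⇔ π⊆ν (All.lookup ν⊆π)) π≉ν
    where
    π⊆ν : ∀ {C} → C ∈ₗ blocks π → C ∈ₗ blocks ν
    π⊆ν C∈ with NoncrossingPartition.nonempty π C∈
    ... | y , y∈C with NoncrossingPartition.covers ν y
    ...   | V , V∈ , y∈V = subst (_∈ₗ blocks ν)
      (same-block (NoncrossingPartition.isSetPartition π) (All.lookup ν⊆π V∈) C∈ y∈V y∈C) V∈
  ... | no ν⊈π with find (All.¬All⇒Any¬ (_∈? blocks π) (blocks ν) ν⊈π)
    where open import Data.List.Membership.DecPropositional (_≟ˢ_ {n}) using (_∈?_)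
  ...   | V , V∈ , V∉ with bk (Merge.τ π ν π≤ν V∈ V∉) ℕ.≟ bk ν
  ...     | no  ne = contradiction
              ((π≤τ , π≉τ) , (τ≤ν , λ e → ne (bk-cong {π = τ} {ν} e))) (none τ)
    where open Merge π ν π≤ν V∈ V∉
  ...     | yes e = trans (cong (n ∸_) (sym e))
              (trans (ℕ.+-∸-assoc 1 (subst (ℕ._≤ n) bk-τ (bk≤n π))) (cong (λ k → suc (n ∸ k)) (sym bk-τ)))
    where open Merge π ν π≤ν V∈ V∉

NCᴬ : ℕ → RankedPoset
NCᴬ n = record
  { poset = ≤ᴺ-poset n
  ; rank = λ π → n ∸ bk π
  ; rank-cong = λ {π} {ν} π≈ν → cong (n ∸_) (bk-cong {π = π} {ν} π≈ν)
  ; rank-minimal = rankᴺ-minimal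
  ; rank-cover = λ {π} {ν} → rankᴺ-cover π ν
  ; elements = enumerate (sublists (subsets n))
  ; complete = λ (ncp bs isP nc) → enumerate-any
      (Any.map (λ (cs! , e) → isNCP-resp cs! e (isP , nc) , λ _ B → e {B}) (canonical bs))
  ; unique = enumerate-pairs (AllPairs.map (λ d _ _ e → distinguished⇒≁ d λ {B} → e B)
      (sublists-distinct (subsets n) (subsets-unique n)))
  }
  where open Enumerate (isNCP? {n}) (λ bs p → ncp bs (proj₁ p) (proj₂ p))

{-# OPTIONS --safe #-}
-- Call node X Q the ordered forest whose first tree has X below its root and whose other
-- trees form Q.  Both posets are enumerated by the forests with n vertices so that the
-- rank is the number of internal vertices:
-- · deleting the first value of a 132-avoiding permutation removes the first root of the
--   forest, the value recording its number of children; position i is a descent iff the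
--   i-th vertex in preorder is internal;
-- · in a noncrossing partition of {0, …, n - 1} the largest element k of the block of 0
--   cuts off a partition of {1, …, k} and one of {k + 1, …, n - 1}, coded by X and Q.
-- Ordered by the marks of their internal vertices in preorder, the forests split into
-- symmetric saturated chains by induction on n: the cases X = ∅ and Q = ∅ together are the
-- product of the forests on n - 1 vertices with a 2-element chain, every other pair of
-- sizes contributes a product of two smaller such posets, and a product of two symmetric
-- chains is a union of hooks.  A symmetric chain decomposition gives the rank properties;
-- for the Sperner property, a union of k antichains meets a chain C in at most
-- min(k, |C|) elements, and the k middle ranks meet it in at least that many.

module Submission where

open import Defs
import Algebra.Bundles
open import Data.Bool.Base using (Bool; true; false)
import Data.Bool.Base as Bool
import Data.Bool.Properties as Bool
open import Data.Fin.Base as Fin using (Fin; zero; suc; toℕ; fromℕ<; punchIn)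
open import Data.Fin.Permutation as Perm using (Permutation′; _⟨$⟩ʳ_; _⟨$⟩ˡ_; insert; remove)
import Data.Fin.Properties as Fin
open import Data.Fin.Subset as Subset using (Subset; _⊆_; _⊂_; ∣_∣)
import Data.Fin.Subset.Properties as Subset
open import Data.List.Base
  using (List; []; _∷_; _++_; length; filter; map; concat; concatMap; take; lookup; reverse; _ʳ++_; upTo; applyUpTo; allFin; cartesianProductWith)
open import Data.List.Membership.Propositional using (_∈_; lose)
open import Data.List.Membership.Propositional.Properties
import Data.List.Membership.Setoid as SetoidMembership
import Data.List.Membership.Setoid.Properties as SetoidMembershipₚ
open import Data.List.Properties hiding (sum-++)
open import Data.List.Relation.Binary.Permutation.Propositional
  using (_↭_; ↭-sym; ↭-trans; ↭-reflexive; ↭⇒↭ₛ; prep; refl)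
open import Data.List.Relation.Binary.Permutation.Propositional.Properties
  using (++⁺; ++⁺ˡ; ++-comm; ++-commutativeMonoid; shift; shifts; ↭-reverse; ++↭ʳ++; ↭-length; ↭-map-inv; ∈-resp-↭; All-resp-↭)
  renaming (map⁺ to ↭-map⁺)
import Data.List.Relation.Binary.Permutation.Setoid.Properties as ↭ₛ
open import Data.List.Relation.Binary.Pointwise as Pointwise using (Pointwise; []; _∷_)
open import Data.List.Relation.Unary.All as All using (All; []; _∷_)
import Data.List.Relation.Unary.All.Properties as All
open import Data.List.Relation.Unary.AllPairs as AllPairs using (AllPairs; []; _∷_)
import Data.List.Relation.Unary.AllPairs.Properties as AllPairs
open import Data.List.Relation.Unary.Any as Any using (Any; here; there)
import Data.List.Relation.Unary.Any.Properties as Any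
import Data.List.Relation.Unary.Sorted.TotalOrder.Properties as Sorted
open import Data.List.Relation.Unary.Unique.Propositional using (Unique)
import Data.List.Relation.Unary.Unique.Propositional.Properties as Unique
import Data.List.Relation.Unary.Unique.Setoid as SetoidUnique
import Data.List.Relation.Unary.Unique.Setoid.Properties as SetoidUniqueₚ
import Data.List.Sort as Sort
open import Data.Nat.Base using (ℕ; zero; suc; pred; _+_; _∸_; _⊓_; _≤_; _<_; z≤n; s≤s; ⌊_/2⌋)
open import Data.Nat.Induction using (<-rec)
open import Data.Nat.ListAction using (sum)
open import Data.Nat.ListAction.Properties using (sum-↭)
open import Data.Nat.Properties
open import Data.List.Extrema ≤-totalOrder using (xs≤max; max≤v⁺)
open import Data.List.Membership.DecPropositional _≟_ using (_∈?_)
open import Data.Nat.Tactic.RingSolver using (solve-∀)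
open import Data.Product.Base using (∃; _×_; _,_; proj₁; proj₂)
open import Data.Sum.Base using (_⊎_; inj₁; inj₂)
open import Data.Vec.Base using ([]; _∷_; tabulate)
import Data.Vec.Properties as Vec
open import Function.Base using (_∘_)
open import Function.Bundles using (_⇔_; mk⇔; Equivalence; Injection)
open import Function.Properties.Inverse using (↔⇒↣)
open import Level using (0ℓ)
open import Relation.Binary.Bundles using (Setoid; Poset)
open import Relation.Binary.Core using (Rel)
import Relation.Binary.Construct.Flip.EqAndOrd as Flip
open import Relation.Binary.Definitions using (DecidableEquality)
open import Relation.Binary.PropositionalEquality hiding (poset)
open import Relation.Nullary.Decidable using (Dec; yes; no; does; dec-true; dec-false; ¬?; _×-dec_)
open import Relation.Nullary.Negation using (¬_; contradiction)

-- Posets with a symmetric chain decomposition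

module _ {A : Set} where

  ↭-partition : {P Q : A → Set} {xs : List A} → All (λ x → P x ⊎ Q x) xs →
                ∃ λ ys → ∃ λ zs → xs ↭ ys ++ zs × All P ys × All Q zs
  ↭-partition [] = [] , [] , refl , [] , []
  ↭-partition (pq ∷ pqs) with ↭-partition pqs
  ↭-partition (inj₁ p ∷ pqs) | ys , zs , xs↭ , ps , qs = _ ∷ ys , zs , prep _ xs↭ , p ∷ ps , qs
  ↭-partition (inj₂ q ∷ pqs) | ys , zs , xs↭ , ps , qs =
    ys , _ ∷ zs , ↭-trans (prep _ xs↭) (↭-sym (shift _ ys zs)) , ps , q ∷ qs

  AllPairs-++⁻ : {R : Rel A 0ℓ} → ∀ xs {ys} → AllPairs R (xs ++ ys) → AllPairs R xs × AllPairs R ys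
  AllPairs-++⁻ []       rs       = [] , rs
  AllPairs-++⁻ (x ∷ xs) (r ∷ rs) with AllPairs-++⁻ xs rs
  ... | rsˡ , rsʳ = All.++⁻ˡ xs r ∷ rsˡ , rsʳ

  ∈⇒f≤sum : (f : A → ℕ) {x : A} {xs : List A} → x ∈ xs → f x ≤ sum (map f xs)
  ∈⇒f≤sum f (here refl) = m≤m+n _ _
  ∈⇒f≤sum f (there x∈)  = ≤-trans (∈⇒f≤sum f x∈) (m≤n+m _ _)

  length≤sum : (f : A → ℕ) {xs : List A} → All (λ x → 1 ≤ f x) xs → length xs ≤ sum (map f xs)
  length≤sum f []       = z≤n
  length≤sum f (p ∷ ps) = +-mono-≤ p (length≤sum f ps)

  length-concat-sum : (xss : List (List A)) → length (concat xss) ≡ sum (map length xss)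
  length-concat-sum []         = refl
  length-concat-sum (xs ∷ xss) = trans (length-++ xs) (cong (length xs +_) (length-concat-sum xss))


  ∈⇒↭∷ : {x : A} {xs : List A} → x ∈ xs → ∃ λ ys → xs ↭ x ∷ ys
  ∈⇒↭∷ x∈ with ∈-∃++ x∈
  ... | ys , zs , refl = ys ++ zs , shift _ ys zs

  Unique-resp-↭ : {xs ys : List A} → xs ↭ ys → Unique xs → Unique ys
  Unique-resp-↭ xs↭ = ↭ₛ.Unique-resp-↭ (setoid A) (↭⇒↭ₛ xs↭)

  ∈-tail : {x y : A} {xs : List A} → x ≢ y × y ∈ x ∷ xs → y ∈ xs
  ∈-tail (x≢y , here y≡x) = contradiction (sym y≡x) x≢y
  ∈-tail (_   , there y∈) = y∈

-- An exchange argument: if the heaviest element `x` occurs in `ys`, it cancels on both sides; if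
-- not, the head of `ys` weighs at most as much as `x`, and all of `ys` lies in the tail. It will
-- compare the middle ranks with the largest ones.
antitone-prefix-maximal : (w : ℕ → ℕ) → ∀ k {xs ys} → AllPairs (λ x y → w y ≤ w x) xs →
  Unique ys → All (_∈ xs) ys → length ys ≤ k → sum (map w ys) ≤ sum (map w (take k xs))
antitone-prefix-maximal w k       {ys = []}         _ _ _ _ = z≤n
antitone-prefix-maximal w (suc k) {[]}     {y ∷ ys} _ _ (() ∷ _) _
antitone-prefix-maximal w (suc k) {x ∷ xs} {y ∷ ys} (x≥ ∷ xs≥) ys! ys⊆ ≤k with x ∈? y ∷ ys
... | yes x∈ with ∈⇒↭∷ x∈
...   | zs , ys↭ with Unique-resp-↭ ys↭ ys! | All-resp-↭ ys↭ ys⊆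
...     | x∉ ∷ zs! | _ ∷ zs⊆ = subst (_≤ sum (map w (x ∷ take k xs))) (sym (sum-↭ (↭-map⁺ w ys↭)))
  (+-monoʳ-≤ (w x) (antitone-prefix-maximal w k xs≥ zs! (All.zipWith ∈-tail (x∉ , zs⊆))
    (≤-pred (subst (_≤ suc k) (↭-length ys↭) ≤k))))
antitone-prefix-maximal w (suc k) {x ∷ xs} {y ∷ ys} (x≥ ∷ xs≥) (y∉ ∷ ys!) ys⊆ (s≤s ≤k) | no x∉
  with All.zipWith ∈-tail (All.¬Any⇒All¬ (y ∷ ys) x∉ , ys⊆)
... | y∈xs ∷ ys⊆xs = +-mono-≤ (All.lookup x≥ y∈xs) (antitone-prefix-maximal w k xs≥ ys! ys⊆xs ≤k)

module _ (S : Setoid 0ℓ 0ℓ) where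
  open Setoid S using (_≈_) renaming (Carrier to A; refl to ≈-refl; sym to ≈-sym)
  open SetoidMembership S using () renaming (_∈_ to _∈≈_)
  open SetoidUnique S using () renaming (Unique to Unique≈)

  Unique≈-resp-↭ : {xs ys : List A} → xs ↭ ys → Unique≈ xs → Unique≈ ys
  Unique≈-resp-↭ xs↭ = ↭ₛ.AllPairs-resp-↭ (setoid A) (λ x≉y y≈x → x≉y (≈-sym y≈x))
    ((λ { refl h → h }) , (λ { refl h → h })) (↭⇒↭ₛ xs↭)

  ≈-lookup-injective : ∀ {xs} → Unique≈ xs → ∀ i j → lookup xs i ≈ lookup xs j → i ≡ j
  ≈-lookup-injective (_  ∷ _)   zero    zero    _ = refl
  ≈-lookup-injective (x∉ ∷ _)   zero    (suc j) e = contradiction e (All.lookup x∉ (∈-lookup j))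
  ≈-lookup-injective (x∉ ∷ _)   (suc i) zero    e = contradiction (≈-sym e) (All.lookup x∉ (∈-lookup i))
  ≈-lookup-injective (_  ∷ xs!) (suc i) (suc j) e = cong suc (≈-lookup-injective xs! i j e)

  -- The pigeonhole principle: a choice of colour for each position is injective, because equally
  -- coloured entries agree and `xs` has no repetitions. The colours will be the antichains of a
  -- union, or the positions in another list.
  colouring-bounds-length : ∀ {k xs} {P : A → Fin k → Set} → Unique≈ xs → All (λ x → ∃ (P x)) xs →
    (∀ {x y} → x ∈ xs → y ∈ xs → ∀ {i} → P x i → P y i → x ≈ y) → length xs ≤ k
  colouring-bounds-length {xs = xs} {P} xs! col same = Fin.injective⇒≤ {f = λ i → proj₁ (colour i)}
    λ {i} {j} e → ≈-lookup-injective xs! i j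
      (same (∈-lookup i) (∈-lookup j) (proj₂ (colour i)) (subst (P _) (sym e) (proj₂ (colour j))))
    where
    colour : ∀ i → ∃ (P (lookup xs i))
    colour i = All.lookup col (∈-lookup i)

  length-mono-∈≈ : ∀ {xs ys} → Unique≈ xs → All (_∈≈ ys) xs → length xs ≤ length ys
  length-mono-∈≈ {xs} {ys} xs! xs⊆ = colouring-bounds-length
    {P = λ x i → ∃ λ (x∈ : x ∈≈ ys) → Any.index x∈ ≡ i} xs! (All.map (λ x∈ → _ , x∈ , refl) xs⊆)
    λ { _ _ (x∈ , refl) (y∈ , e) → SetoidMembershipₚ.index-injective S x∈ y∈ (sym e) }

-- Counting the entries of a list by rank

module _ {A : Set} (rk : A → ℕ) where

  level : ℕ → List A → ℕ
  level i xs = length (filter (λ x → rk x ≟ i) xs)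

  window : List ℕ → List A → ℕ
  window is xs = sum (map (λ i → level i xs) is)

  level-++ : ∀ i xs ys → level i (xs ++ ys) ≡ level i xs + level i ys
  level-++ i xs ys = trans (cong length (filter-++ (λ x → rk x ≟ i) xs ys)) (length-++ (filter (λ x → rk x ≟ i) xs))

  window-++ : ∀ is xs ys → window is (xs ++ ys) ≡ window is xs + window is ys
  window-++ []       xs ys = refl
  window-++ (i ∷ is) xs ys rewrite window-++ is xs ys | level-++ i xs ys =
    interchange (level i xs) (level i ys) (window is xs) (window is ys)
    where open import Algebra.Properties.CommutativeSemigroup +-commutativeSemigroup using (interchange)

  length≤window : ∀ {is xs} → All (λ x → rk x ∈ is) xs → length xs ≤ window is xs
  length≤window {is} []                   = z≤n
  length≤window {is} {x ∷ xs} (x∈ ∷ xs∈) = subst (suc (length xs) ≤_) (sym (window-++ is (x ∷ []) xs))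
    (+-mono-≤ (≤-trans (≤-reflexive (sym level-self)) (∈⇒f≤sum (λ i → level i (x ∷ [])) x∈)) (length≤window xs∈))
    where
    level-self : level (rk x) (x ∷ []) ≡ 1
    level-self = cong length (filter-accept (λ y → rk y ≟ rk x) {xs = []} refl)

  level-concat-mono : ∀ i j {xss} → All (λ xs → level i xs ≤ level j xs) xss →
                      level i (concat xss) ≤ level j (concat xss)
  level-concat-mono i j [] = z≤n
  level-concat-mono i j {xs ∷ xss} (h ∷ hs) rewrite level-++ i xs (concat xss) | level-++ j xs (concat xss) =
    +-mono-≤ h (level-concat-mono i j hs)

  window-concat-≥ : (f : List A → ℕ) → ∀ is {xss} → All (λ xs → f xs ≤ window is xs) xss →
                    sum (map f xss) ≤ window is (concat xss)
  window-concat-≥ f is [] = z≤n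
  window-concat-≥ f is {xs ∷ xss} (h ∷ hs) rewrite window-++ is xs (concat xss) =
    +-mono-≤ h (window-concat-≥ f is hs)

level-∷ : {A B : Set} (rk : A → ℕ) (rk′ : B → ℕ) → ∀ k {x y xs ys} → rk x ≡ rk′ y →
          level rk k xs ≡ level rk′ k ys → level rk k (x ∷ xs) ≡ level rk′ k (y ∷ ys)
level-∷ rk rk′ k {x} {y} e h with rk x ≟ k
... | yes x≡k = trans (cong length (filter-accept (λ z → rk z ≟ k) x≡k))
                  (trans (cong suc h) (sym (cong length (filter-accept (λ z → rk′ z ≟ k) (trans (sym e) x≡k)))))
... | no  x≢k = trans (cong length (filter-reject (λ z → rk z ≟ k) x≢k))
                  (trans h (sym (cong length (filter-reject (λ z → rk′ z ≟ k) (x≢k ∘ trans e)))))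

level-map : {A B : Set} (rk : A → ℕ) (rk′ : B → ℕ) (f : B → A) → ∀ k {xs} →
            All (λ x → rk (f x) ≡ rk′ x) xs → level rk k (map f xs) ≡ level rk′ k xs
level-map rk rk′ f k []       = refl
level-map rk rk′ f k (e ∷ es) = level-∷ rk rk′ k e (level-map rk rk′ f k es)

-- Saturated chains and their levels

module Chains {A : Set} (rk : A → ℕ) (_⊑_ : Rel A 0ℓ) where

  -- The ranks are `s`, `s + 1`, and so on. Each entry is stored as below all later ones, so that
  -- comparisons across the chain need no composition of steps.
  data Up : ℕ → List A → Set where
    []   : ∀ {s} → Up s []
    cons : ∀ {s x xs} → rk x ≡ s → All (x ⊑_) xs → Up (suc s) xs → Up s (x ∷ xs)

  SymmetricChain : ℕ → List A → Set
  SymmetricChain r xs = ∃ λ s → Up s xs × s + s + length xs ≡ suc r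

  Up-ranks : ∀ {s xs} → Up s xs → All (λ x → s ≤ rk x × rk x < s + length xs) xs
  Up-ranks [] = []
  Up-ranks (cons {s} {x} {xs} refl _ up) = (≤-refl , m<m+n s (s≤s z≤n))
    ∷ All.map (λ {y} (s< , <e) → <⇒≤ s< , subst (rk y <_) (sym (+-suc s (length xs))) <e) (Up-ranks up)

  Up-level-outside : ∀ {s xs i} → Up s xs → i < s ⊎ s + length xs ≤ i → level rk i xs ≡ 0
  Up-level-outside [] _ = refl
  Up-level-outside {s} {x ∷ xs} {i} (cons e _ up) h =
    trans (cong length (filter-reject (λ y → rk y ≟ i) (off h))) (Up-level-outside up (next h))
    where
    off : i < s ⊎ s + suc (length xs) ≤ i → rk x ≢ i
    off (inj₁ i<s) refl = <-irrefl e i<s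
    off (inj₂ e≤i) refl = <⇒≱ (m<m+n s (s≤s z≤n)) (subst (_ ≤_) e e≤i)
    next : i < s ⊎ s + suc (length xs) ≤ i → i < suc s ⊎ suc s + length xs ≤ i
    next (inj₁ i<s) = inj₁ (m≤n⇒m≤1+n i<s)
    next (inj₂ e≤i) = inj₂ (subst (_≤ i) (+-suc s (length xs)) e≤i)

  Up-level-inside : ∀ {s xs i} → Up s xs → s ≤ i → i < s + length xs → level rk i xs ≡ 1
  Up-level-inside {s} [] s≤i i<e = contradiction (subst (_ <_) (+-identityʳ s) i<e) (≤⇒≯ s≤i)
  Up-level-inside {s} {x ∷ xs} {i} (cons e _ up) s≤i i<e with rk x ≟ i
  ... | yes x≡i = trans (cong length (filter-accept (λ y → rk y ≟ i) x≡i))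
                    (cong suc (Up-level-outside up (inj₁ (s≤s (≤-reflexive (trans (sym x≡i) e))))))
  ... | no  x≢i = trans (cong length (filter-reject (λ y → rk y ≟ i) x≢i))
                    (Up-level-inside up (≤∧≢⇒< s≤i (x≢i ∘ trans e)) (subst (i <_) (+-suc s (length xs)) i<e))

  module _ {r xs} (C : SymmetricChain r xs) where
    private
      s = proj₁ C
      up = proj₁ (proj₂ C)
      total : s + (s + length xs) ≡ suc r
      total = trans (sym (+-assoc s s (length xs))) (proj₂ (proj₂ C))

    level-inside : ∀ {i} → s ≤ i → i + s ≤ r → level rk i xs ≡ 1
    level-inside {i} s≤i i+s≤r = Up-level-inside up s≤i
      (+-cancelˡ-≤ s _ _ (subst₂ _≤_ (trans (cong suc (+-comm i s)) (sym (+-suc s i))) (sym total) (s≤s i+s≤r)))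

    level-outside : ∀ {i} → i < s ⊎ r < i + s → level rk i xs ≡ 0
    level-outside (inj₁ i<s) = Up-level-outside up (inj₁ i<s)
    level-outside {i} (inj₂ r<i+s) = Up-level-outside up
      (inj₂ (+-cancelˡ-≤ s _ _ (subst₂ _≤_ (sym total) (+-comm i s) r<i+s)))

    -- A chain meets each rank at most once, so only an `i` between `s` and `r - s` matters; the
    -- hypothesis then puts `j` in the same interval.
    level-mono : ∀ {i j} → (s ≤ i → i + s ≤ r → s ≤ j × j + s ≤ r) → level rk i xs ≤ level rk j xs
    level-mono {i} {j} h with s ≤? i | i + s ≤? r
    ... | no s≰i  | _        = subst (_≤ level rk j xs) (sym (level-outside (inj₁ (≰⇒> s≰i)))) z≤n
    ... | yes _   | no i+s≰r = subst (_≤ level rk j xs) (sym (level-outside (inj₂ (≰⇒> i+s≰r)))) z≤n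
    ... | yes s≤i | yes i+s≤r with h s≤i i+s≤r
    ...   | s≤j , j+s≤r = ≤-reflexive (trans (level-inside s≤i i+s≤r) (sym (level-inside s≤j j+s≤r)))

    level-reflect : ∀ {i} → i ≤ r → level rk i xs ≤ level rk (r ∸ i) xs
    level-reflect {i} i≤r = level-mono λ s≤i i+s≤r →
        m+n≤o⇒m≤o∸n s (subst (_≤ r) (+-comm i s) i+s≤r)
      , subst (r ∸ i + s ≤_) (m∸n+n≡m i≤r) (+-monoʳ-≤ (r ∸ i) s≤i)

    level-ascend : ∀ {i} → suc i + i ≤ r → level rk i xs ≤ level rk (suc i) xs
    level-ascend {i} h = level-mono λ s≤i _ → m≤n⇒m≤1+n s≤i , ≤-trans (+-monoʳ-≤ (suc i) s≤i) h

    level-descend : ∀ {i} → r ≤ suc (i + i) → level rk (suc i) xs ≤ level rk i xs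
    level-descend {i} h = level-mono λ _ 1+i+s≤r →
        -- With `i < s`, the bound `suc i + s ≤ r` would give `2i + 2 ≤ r`, against `r ≤ 2i + 1`.
        ≮⇒≥ (λ i<s → 1+n≰n (≤-trans (≤-trans (+-monoʳ-≤ (suc i) i<s) 1+i+s≤r)
          (≤-trans h (≤-reflexive (sym (+-suc i i))))))
      , <⇒≤ 1+i+s≤r

    rank-≤ : All (λ x → rk x ≤ r) xs
    rank-≤ = All.map (λ {y} (_ , <e) → ≤-pred (subst (suc (rk y) ≤_) total (≤-trans <e (m≤n+m _ s)))) (Up-ranks up)

    -- A chain starting at rank ≤ a meets every rank of [a, a + k), and any other
    -- chain has all its ranks there.
    middle-window : ∀ {a k} → a + (a + k) ≤ suc r → r ≤ a + (a + k) →
                    k ⊓ length xs ≤ window rk (applyUpTo (a +_) k) xs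
    middle-window {a} {k} lo hi with s ≤? a
    ... | yes s≤a = ≤-trans (m⊓n≤m k _) (≤-trans (≤-reflexive (sym (length-applyUpTo (a +_) k)))
          (length≤sum (λ i → level rk i xs) (All.applyUpTo⁺₁ (a +_) k λ {i} i<k → ≤-reflexive (sym
            (level-inside (≤-trans s≤a (m≤m+n a i))
              (≤-pred (≤-trans (+-monoˡ-≤ s (+-monoʳ-< a i<k))
                (≤-trans (+-monoʳ-≤ (a + k) s≤a) (≤-trans (≤-reflexive (+-comm (a + k) a)) lo)))))))))
    ... | no s≰a = ≤-trans (m⊓n≤n k _) (length≤window rk (All.map in-window (Up-ranks up)))
      where
      e≤ : s + length xs ≤ a + k
      e≤ = +-cancelˡ-≤ (suc a) _ _ (≤-trans (+-monoˡ-≤ _ (≰⇒> s≰a)) (≤-trans (≤-reflexive total) (s≤s hi)))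
      in-window : ∀ {x} → s ≤ rk x × rk x < s + length xs → rk x ∈ applyUpTo (a +_) k
      in-window {x} (s≤ , <e) = subst (_∈ applyUpTo (a +_) k) (m+[n∸m]≡n a≤)
        (∈-applyUpTo⁺ (a +_) (+-cancelˡ-< a _ _ (subst (_< a + k) (sym (m+[n∸m]≡n a≤)) (≤-trans <e e≤))))
        where
        a≤ : a ≤ rk x
        a≤ = ≤-trans (<⇒≤ (≰⇒> s≰a)) s≤

-- Rank properties from a symmetric chain decomposition

module _ (P : RankedPoset) where
  open RankedPoset P
  private
    S = Poset.Eq.setoid poset
    module ≈ = Setoid S

  filter-rank : ∀ k → List Carrier → List Carrier
  filter-rank k = filter (λ x → rank x ≟ k)

  ∈≈-filter-rank⁺ : ∀ {k x xs} → x ∈≈ xs → rank x ≡ k → x ∈≈ filter-rank k xs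
  ∈≈-filter-rank⁺ {k} = SetoidMembershipₚ.∈-filter⁺ S (λ x → rank x ≟ k) (λ e → trans (sym (rank-cong e)))

  ∈≈-filter-rank⁻ : ∀ {k x xs} → x ∈≈ filter-rank k xs → x ∈≈ xs × rank x ≡ k
  ∈≈-filter-rank⁻ {k} = SetoidMembershipₚ.∈-filter⁻ S (λ x → rank x ≟ k) (λ e → trans (sym (rank-cong e)))

  level-mono-∈≈ : ∀ k {xs ys} → Unique≈ xs → (∀ x → x ∈≈ ys) → level rank k xs ≤ level rank k ys
  level-mono-∈≈ k {xs} xs! ys∋ = length-mono-∈≈ S (SetoidUniqueₚ.filter⁺ S (λ x → rank x ≟ k) xs!)
    (All.map (∈≈-filter-rank⁺ (ys∋ _)) (All.all-filter (λ x → rank x ≟ k) xs))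

  -- Frees the rank sizes from the given list `elements`: they may be counted along the chains or
  -- along the forests instead.
  rankSize-enumeration : ∀ {xs} → Unique≈ xs → (∀ x → x ∈≈ xs) → ∀ k → rankSize P k ≡ level rank k xs
  rankSize-enumeration xs! xs∋ k = ≤-antisym (level-mono-∈≈ k unique xs∋) (level-mono-∈≈ k xs! complete)

  maxRank-≡ : ∀ {r} → (∀ x → rank x ≤ r) → (∃ λ x → rank x ≡ r) → maxRank P ≡ r
  maxRank-≡ {r} ≤r (x , refl) = ≤-antisym
    (max≤v⁺ z≤n (All.map⁺ (All.universal ≤r elements)))
    (All.lookupWith (λ { {y} ry≤ x≈y → ≤-trans (≤-reflexive (rank-cong x≈y)) ry≤ })
      (All.map⁻ (xs≤max 0 (map rank elements))) (complete x))

  module SymmetricChainDecomposition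
    (rank-strict : ∀ x y → x ≼ y → rank x ≡ rank y → x ≈ y)
    (r : ℕ) (top : ∃ λ x → rank x ≡ r)
    (chains : List (List Carrier))
    (covered : ∀ x → x ∈≈ concat chains) (once : Unique≈ (concat chains))
    (symmetric : All (Chains.SymmetricChain rank _≼_ r) chains)
    where
    open Chains rank _≼_

    rankSize-chains : ∀ k → rankSize P k ≡ level rank k (concat chains)
    rankSize-chains = rankSize-enumeration once covered

    maxRank≡r : maxRank P ≡ r
    maxRank≡r = maxRank-≡ (λ x → All.lookupWith (λ { ry≤ x≈y → ≤-trans (≤-reflexive (rank-cong x≈y)) ry≤ })
      (All.concat⁺ (All.map rank-≤ symmetric)) (covered x)) top

    rankSize-mono : ∀ i j → (∀ {xs} → SymmetricChain r xs → level rank i xs ≤ level rank j xs) →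
                    rankSize P i ≤ rankSize P j
    rankSize-mono i j h rewrite rankSize-chains i | rankSize-chains j = level-concat-mono rank i j (All.map h symmetric)

    rankSymmetric : RankSymmetric P
    rankSymmetric rewrite maxRank≡r = λ k k≤r → ≤-antisym
      (rankSize-mono k (r ∸ k) (λ C → level-reflect C k≤r))
      -- Reflection is an involution on the ranks up to `r`, so the same inequality at `r - k` is
      -- the converse one.
      (subst (λ j → rankSize P (r ∸ k) ≤ rankSize P j) (m∸[m∸n]≡n k≤r)
        (rankSize-mono (r ∸ k) (r ∸ (r ∸ k)) (λ C → level-reflect C (m∸n≤m r k))))

    rankUnimodal : RankUnimodal P
    rankUnimodal rewrite maxRank≡r = ⌊ r /2⌋ , ⌊n/2⌋≤n r
      , (λ i i<h → rankSize-mono i (suc i) λ C → level-ascend C (≤-trans (+-mono-≤ i<h (<⇒≤ i<h)) h+h≤r))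
      , (λ i h≤i _ → rankSize-mono (suc i) i λ C → level-descend C
          (≤-trans r≤1+h+h (s≤s (+-mono-≤ h≤i h≤i))))
      where
      h+h≤r : ⌊ r /2⌋ + ⌊ r /2⌋ ≤ r
      h+h≤r = subst (⌊ r /2⌋ + ⌊ r /2⌋ ≤_) (⌊n/2⌋+⌈n/2⌉≡n r) (+-monoʳ-≤ ⌊ r /2⌋ (⌊n/2⌋≤⌈n/2⌉ r))
      r≤1+h+h : r ≤ suc (⌊ r /2⌋ + ⌊ r /2⌋)
      r≤1+h+h = subst (_≤ suc (⌊ r /2⌋ + ⌊ r /2⌋)) (⌊n/2⌋+⌈n/2⌉≡n r)
        (≤-trans (+-monoʳ-≤ ⌊ r /2⌋ (⌊n/2⌋-mono (n≤1+n (suc r)))) (≤-reflexive (+-suc ⌊ r /2⌋ ⌊ r /2⌋)))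

    private
      head≼ : ∀ {x y c C} → x ≈ c → All (c ≼_) C → y ∈≈ C → x ≼ y
      head≼ x≈c below y∈ = All.lookupWith
        (λ c≼z y≈z → Poset.trans poset (Poset.reflexive poset x≈c)
                       (Poset.trans poset c≼z (Poset.reflexive poset (≈.sym y≈z)))) below y∈

    -- Two members of a chain are comparable, which forces equality in an antichain.
    antichain-meets-chain-once : ∀ {A C s} → IsAntichain P A → Up s C → ∀ {x y} →
      x ∈≈ C → y ∈≈ C → x ∈≈ A → y ∈≈ A → x ≈ y
    antichain-meets-chain-once anti (cons _ _ _) (here x≈) (here y≈) _ _ = ≈.trans x≈ (≈.sym y≈)
    antichain-meets-chain-once anti (cons _ _ up) (there x∈) (there y∈) x∈A y∈A =
      antichain-meets-chain-once anti up x∈ y∈ x∈A y∈A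
    antichain-meets-chain-once {A} anti (cons _ below _) {x} {y} (here x≈) (there y∈) x∈A y∈A =
      anti x y x∈A y∈A (head≼ x≈ below y∈)
    antichain-meets-chain-once {A} anti (cons _ below _) {x} {y} (there x∈) (here y≈) x∈A y∈A =
      ≈.sym (anti y x y∈A x∈A (head≼ y≈ below x∈))

    -- The chains are peeled off one at a time. The part of `U` on a chain `C` has at most `k`
    -- members, since no antichain accounts for two of them, and at most `length C`, since it is
    -- free of repetitions.
    union-bound : ∀ {k U} → IsUnionOfAntichains P k U → length U ≤ sum (map (λ C → k ⊓ length C) chains)
    union-bound {k} {U} isU = go symmetric _ (IsUnionOfAntichains.unique isU)
      (All.tabulate λ u∈ → Equivalence.to (union _) (∈⇒∈≈ u∈)) (All.universal (λ u → covered u) U)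
      where
      open IsUnionOfAntichains isU using (antichain; isAnti; union)
      ∈⇒∈≈ : ∀ {x xs} → x ∈ xs → x ∈≈ xs
      ∈⇒∈≈ = Any.map (λ { refl → ≈.refl })
      go : ∀ {Cs} → All (SymmetricChain r) Cs → ∀ V → Unique≈ V →
           All (λ v → ∃ λ i → v ∈≈ antichain i) V → All (_∈≈ concat Cs) V →
           length V ≤ sum (map (λ C → k ⊓ length C) Cs)
      go []         []      _  _   _        = z≤n
      go []         (_ ∷ _) _  _   (() ∷ _)
      go {C ∷ Cs} ((s , up , _) ∷ ups) V V! col V⊆ with ↭-partition (All.map (Any.++⁻ C) V⊆)
      ... | ys , zs , V↭ , ys⊆ , zs⊆ with AllPairs-++⁻ ys (Unique≈-resp-↭ S V↭ V!) | All.++⁻ ys (All-resp-↭ V↭ col)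
      ...   | ys! , zs! | ys-col , zs-col =
        subst (_≤ _) (sym (trans (↭-length V↭) (length-++ ys)))
          (+-mono-≤
            (⊓-glb
              (colouring-bounds-length S {P = λ v i → v ∈≈ antichain i} ys! ys-col
                λ x∈ y∈ {i} → antichain-meets-chain-once (isAnti i) up (All.lookup ys⊆ x∈) (All.lookup ys⊆ y∈))
              (length-mono-∈≈ S ys! ys⊆))
            (go ups zs zs! zs-col zs⊆))

    private
      w = rankSize P
      -- Sorting sees only the rank sizes; this recovers an order of the ranks themselves that
      -- induces the sorted list.
      sorted : ∃ λ is → sortDescending P (map w (upTo (suc r))) ≡ map w is × upTo (suc r) ↭ is
      sorted = ↭-map-inv w (↭-sym (Sort.sort-↭ (Flip.decTotalOrder ≤-decTotalOrder) (map w (upTo (suc r)))))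
      ranks = proj₁ sorted

      ranks-descending : AllPairs (λ i j → w j ≤ w i) ranks
      ranks-descending = AllPairs.map⁻ (subst (AllPairs (λ i j → j ≤ i)) (proj₁ (proj₂ sorted))
        (Sorted.Sorted⇒AllPairs (Flip.totalOrder ≤-totalOrder)
          (Sort.sort-↗ (Flip.decTotalOrder ≤-decTotalOrder) (map w (upTo (suc r))))))

      ranks-unique : Unique ranks
      ranks-unique = Unique-resp-↭ (proj₂ (proj₂ sorted)) (Unique.upTo⁺ (suc r))

    largestRanksTotal-≡ : ∀ k → largestRanksTotal P k ≡ sum (map w (take k ranks))
    largestRanksTotal-≡ k = cong sum (trans
      (cong (λ m → take k (sortDescending P (map w (upTo (suc m))))) maxRank≡r)
      (trans (cong (take k) (proj₁ (proj₂ sorted))) (take-map k ranks)))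

    -- Each chain `C` meets the middle ranks in at least `k ⊓ length C` elements, so the left side
    -- is at most their total size, which the largest ranks dominate.
    middle-ranks-bound : ∀ k → sum (map (λ C → k ⊓ length C) chains) ≤ largestRanksTotal P k
    middle-ranks-bound k = ≤-trans (window-concat-≥ rank _ mid (All.map middle symmetric))
      (≤-trans (≤-reflexive (cong sum (map-cong (λ i → sym (rankSize-chains i)) mid)))
        (subst (sum (map w mid) ≤_) (sym (largestRanksTotal-≡ k))
          (antitone-prefix-maximal w k ranks-descending
            (Unique.applyUpTo⁺₁ (a +_) k′ λ i<j _ → <⇒≢ (+-monoʳ-< a i<j))
            (All.applyUpTo⁺₁ (a +_) k′ λ i<k′ → ∈-resp-↭ (proj₂ (proj₂ sorted))
              (∈-upTo⁺ (≤-trans (+-monoʳ-< a i<k′) (≤-trans (m≤n+m _ a) lo))))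
            (≤-trans (≤-reflexive (length-applyUpTo (a +_) k′)) (m⊓n≤m k (suc r))))))
      where
      -- Only `r + 1` ranks exist, so `k` is cut down to that number. Of the `d` ranks left out,
      -- half lie below `a`, which centres the window.
      k′ = k ⊓ suc r
      d = suc r ∸ k′
      a = ⌊ d /2⌋
      mid = applyUpTo (a +_) k′
      d+k′ : d + k′ ≡ suc r
      d+k′ = m∸n+n≡m (m⊓n≤n k (suc r))
      lo : a + (a + k′) ≤ suc r
      lo = subst₂ _≤_ (+-assoc a a k′) d+k′ (+-monoˡ-≤ k′
        (subst (a + a ≤_) (⌊n/2⌋+⌈n/2⌉≡n d) (+-monoʳ-≤ a (⌊n/2⌋≤⌈n/2⌉ d))))
      hi : r ≤ a + (a + k′)
      hi = ≤-pred (subst₂ _≤_ d+k′ (cong suc (+-assoc a a k′)) (+-monoˡ-≤ k′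
        (subst (_≤ suc (a + a)) (⌊n/2⌋+⌈n/2⌉≡n d)
          (≤-trans (+-monoʳ-≤ a (⌊n/2⌋-mono (n≤1+n (suc d)))) (≤-reflexive (+-suc a a))))))
      -- Passing from `k` to `k′` loses nothing, because a symmetric chain has at most `r + 1`
      -- elements.
      middle : ∀ {C} → SymmetricChain r C → k ⊓ length C ≤ window rank mid C
      middle {C} sc = ≤-trans
        (⊓-glb (⊓-glb (m⊓n≤m k _) (≤-trans (m⊓n≤n k _) len≤)) (m⊓n≤n k (length C)))
        (middle-window sc lo hi)
        where
        len≤ : length C ≤ suc r
        len≤ = subst (length C ≤_) (proj₂ (proj₂ sc)) (m≤n+m _ _)

    -- If `k` exceeds the number of ranks, the surplus antichains of the union are empty.
    nth : ∀ k → List (List Carrier) → Fin k → List Carrier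
    nth (suc k) []         i       = []
    nth (suc k) (xs ∷ xss) zero    = xs
    nth (suc k) (xs ∷ xss) (suc i) = nth k xss i

    nth-All : {Q : List Carrier → Set} → Q [] → ∀ k {xss} → All Q xss → ∀ i → Q (nth k xss i)
    nth-All q (suc k) []       i       = q
    nth-All q (suc k) (p ∷ ps) zero    = p
    nth-All q (suc k) (p ∷ ps) (suc i) = nth-All q k ps i

    ∈-nth⁺ : ∀ k xss {x} → x ∈≈ concat (take k xss) → ∃ λ i → x ∈≈ nth k xss i
    ∈-nth⁺ (suc k) (xs ∷ xss) x∈ with Any.++⁻ xs x∈
    ... | inj₁ x∈xs = zero , x∈xs
    ... | inj₂ x∈xss with ∈-nth⁺ k xss x∈xss
    ...   | i , x∈i = suc i , x∈i

    ∈-nth⁻ : ∀ k xss {x} i → x ∈≈ nth k xss i → x ∈≈ concat (take k xss)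
    ∈-nth⁻ (suc k) (xs ∷ xss) zero    x∈ = Any.++⁺ˡ x∈
    ∈-nth⁻ (suc k) (xs ∷ xss) (suc i) x∈ = Any.++⁺ʳ xs (∈-nth⁻ k xss i x∈)

    largest-ranks-union : ∀ k → ∃ λ U → IsUnionOfAntichains P k U × length U ≡ largestRanksTotal P k
    largest-ranks-union k = concat (take k levels)
      , record
        { unique    = SetoidUniqueₚ.concat⁺ S
            (All.take⁺ k (All.map⁺ (All.universal (λ i → SetoidUniqueₚ.filter⁺ S (λ x → rank x ≟ i) unique) ranks)))
            (AllPairs.take⁺ k (AllPairs.map⁺ (AllPairs.map
              (λ i≢j {x} (x∈ : x ∈≈ _ × x ∈≈ _) → i≢j (trans
                (sym (proj₂ (∈≈-filter-rank⁻ {xs = elements} (proj₁ x∈))))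
                (proj₂ (∈≈-filter-rank⁻ {xs = elements} (proj₂ x∈))))) ranks-unique)))
        ; antichain = nth k levels
        ; isAnti    = nth-All {IsAntichain P} (λ _ _ ()) k (All.map⁺ (All.universal level-antichain ranks))
        ; union     = λ x → mk⇔ (∈-nth⁺ k levels) (λ (i , x∈) → ∈-nth⁻ k levels i x∈)
        }
      , trans (length-concat-sum (take k levels))
          (trans (cong sum (trans (cong (map length) (take-map k ranks)) (sym (map-∘ (take k ranks)))))
            (sym (largestRanksTotal-≡ k)))
      where
      levels = map (λ i → filter-rank i elements) ranks
      level-antichain : ∀ i → IsAntichain P (filter-rank i elements)
      level-antichain i x y x∈ y∈ x≼y = rank-strict x y x≼y
        (trans (proj₂ (∈≈-filter-rank⁻ {xs = elements} x∈)) (sym (proj₂ (∈≈-filter-rank⁻ {xs = elements} y∈))))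

    stronglySperner : StronglySperner P
    stronglySperner k _ = largest-ranks-union k , λ U isU → ≤-trans (union-bound isU) (middle-ranks-bound k)

-- Forests and their chains

module _ {A B : Set} {rk : A → ℕ} {_⊑_ : Rel A 0ℓ} {rk′ : B → ℕ} {_⊑′_ : Rel B 0ℓ} where
  open Chains rk _⊑_
  open Chains rk′ _⊑′_ using () renaming (Up to Up′)

  -- Monotonicity is asked only of pairs of increasing rank: in `Pᴬ`, an inclusion of descent sets
  -- gives a comparison only if it is strict.
  Up-map : {Q : A → Set} (h : A → B) (k : ℕ) → (∀ {x} → Q x → rk′ (h x) ≡ k + rk x) →
           (∀ {x y} → Q x → Q y → rk x < rk y → x ⊑ y → h x ⊑′ h y) →
           ∀ {s xs} → All Q xs → Up s xs → Up′ (k + s) (map h xs)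
  Up-map h k shift mono [] [] = Chains.[]
  Up-map h k shift mono {s} {x ∷ xs} (q ∷ qs) (cons e below up) = Chains.cons (trans (shift q) (cong (k +_) e))
    (All.map⁺ (All.zipWith (λ (qy , x⊑y , (s< , _)) → mono q qy (subst (_< _) (sym e) s<) x⊑y)
      (qs , All.zip (below , Up-ranks up))))
    (subst (λ s → Up′ s (map h xs)) (+-suc k s) (Up-map h k shift mono qs up))

module DownChains {A : Set} (rk : A → ℕ) (_⊑_ : Rel A 0ℓ) where
  open Chains rk _⊑_

  -- The index is one more than the rank of the first element.
  data Down : ℕ → List A → Set where
    []   : ∀ {t} → Down t []
    cons : ∀ {t x xs} → rk x ≡ t → All (_⊑ x) xs → Down t xs → Down (suc t) (x ∷ xs)

  Up-ʳ++-Down : ∀ {s xs ys} → Up s xs → Down s ys → All (λ x → All (_⊑ x) ys) xs →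
                Down (s + length xs) (xs ʳ++ ys)
  Up-ʳ++-Down {s} [] down _ = subst (λ t → Down t _) (sym (+-identityʳ s)) down
  Up-ʳ++-Down {s} {x ∷ xs} {ys} (cons e x⊑ up) down (⊑x ∷ h) = subst (λ t → Down t (xs ʳ++ x ∷ ys)) (sym (+-suc s (length xs)))
    (Up-ʳ++-Down up (cons e ⊑x down) (All.zipWith (λ (x⊑y , hy) → x⊑y ∷ hy) (x⊑ , h)))

  reverse-Up : ∀ {s xs} → Up s xs → Down (s + length xs) (reverse xs)
  reverse-Up {xs = xs} up = Up-ʳ++-Down up [] (All.universal (λ _ → []) xs)

  -- The descending `xs` ends at rank `b` and `ys` starts one rank above the head of `xs`, so
  -- reversing `xs` onto `ys` leaves no gap.
  Down-ʳ++-Up : ∀ {b xs ys} → Down (b + length xs) xs → Up (b + length xs) ys → All (λ x → All (x ⊑_) ys) xs →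
                Up b (xs ʳ++ ys)
  Down-ʳ++-Up {b} {[]} _ up _ = subst (λ t → Up t _) (+-identityʳ b) up
  Down-ʳ++-Up {b} {x ∷ xs} down up (x⊑ ∷ h) with b + suc (length xs) | +-suc b (length xs)
  Down-ʳ++-Up (cons e ⊑x down) up (x⊑ ∷ h) | _ | refl =
    Down-ʳ++-Up down (cons e x⊑ up) (All.zipWith (λ (y⊑x , hy) → y⊑x ∷ hy) (⊑x , h))

module _ {A B : Set} {rk : A → ℕ} {_⊑_ : Rel A 0ℓ} {rk′ : B → ℕ} {_⊑′_ : Rel B 0ℓ} where
  open DownChains rk _⊑_
  open DownChains rk′ _⊑′_ using () renaming (Down to Down′)

  Down-map : (h : A → B) (k : ℕ) → (∀ x → rk′ (h x) ≡ k + rk x) → (∀ {x y} → x ⊑ y → h x ⊑′ h y) →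
             ∀ {s xs} → Down s xs → Down′ (k + s) (map h xs)
  Down-map h k shift mono []                = DownChains.[]
  Down-map h k shift mono (cons {t} {x} {xs} e above down) = subst (λ s → Down′ s (map h (x ∷ xs))) (sym (+-suc k t))
    (DownChains.cons (trans (shift _) (cong (k +_) e)) (All.map⁺ (All.map mono above)) (Down-map h k shift mono down))

module _ {A : Set} where
  open import Algebra.Properties.CommutativeSemigroup
    (Algebra.Bundles.CommutativeMonoid.commutativeSemigroup (++-commutativeMonoid {A = A})) public
    using () renaming (interchange to ++-interchange)

-- Hook decomposition of a product of chains

module _ {A B C : Set} (f : A → B → C) where

  prod : List A → List B → List C
  prod = cartesianProductWith f

  prod-∷ʳ : ∀ xs y ys → prod xs (y ∷ ys) ↭ map (λ x → f x y) xs ++ prod xs ys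
  prod-∷ʳ []       y ys = refl
  prod-∷ʳ (x ∷ xs) y ys = prep _ (↭-trans (++⁺ˡ (map (f x) ys) (prod-∷ʳ xs y ys))
    (shifts (map (f x) ys) (map (λ x → f x y) xs)))

  prod-++ʳ : ∀ xs ys zs → prod xs (ys ++ zs) ↭ prod xs ys ++ prod xs zs
  prod-++ʳ []       ys zs = refl
  prod-++ʳ (x ∷ xs) ys zs = ↭-trans
    (++⁺ (↭-reflexive (map-++ (f x) ys zs)) (prod-++ʳ xs ys zs))
    (++-interchange (map (f x) ys) (map (f x) zs) (prod xs ys) (prod xs zs))

  prod-↭ʳ : ∀ xs {ys zs} → ys ↭ zs → prod xs ys ↭ prod xs zs
  prod-↭ʳ []       _ = refl
  prod-↭ʳ (x ∷ xs) p = ++⁺ (↭-map⁺ (f x) p) (prod-↭ʳ xs p)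

  -- For xs increasing and ys decreasing, the hooks
  -- (x₁, yₗ) < ⋯ < (x₁, y₁) < (x₂, y₁) < ⋯ < (xₖ, y₁), (x₂, yₗ) < ⋯ < (x₂, y₂) < (x₃, y₂) < ⋯, …
  -- decompose the product of the two chains.
  hooks : List A → List B → List (List C)
  hooks []       _        = []
  hooks (x ∷ xs) []       = []
  hooks (x ∷ xs) (y ∷ ys) = (map (f x) (y ∷ ys) ʳ++ map (λ z → f z y) xs) ∷ hooks xs ys

  -- The first hook is the row of `x` together with the rest of the column of `y`; what is left is
  -- the product of the tails.
  hooks-↭ : ∀ xs ys → concat (hooks xs ys) ↭ prod xs ys
  hooks-↭ []       ys       = refl
  hooks-↭ (x ∷ xs) []       = ↭-reflexive (sym (cartesianProductWith-zeroʳ f xs))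
  hooks-↭ (x ∷ xs) (y ∷ ys) = ↭-trans
    (++⁺ (↭-sym (++↭ʳ++ (map (f x) (y ∷ ys)) (map (λ z → f z y) xs))) (hooks-↭ xs ys))
    (↭-trans (↭-reflexive (++-assoc (map (f x) (y ∷ ys)) (map (λ z → f z y) xs) (prod xs ys)))
      (++⁺ˡ (map (f x) (y ∷ ys)) (↭-sym (prod-∷ʳ xs y ys))))

  chainProduct : List (List A) → List (List B) → List (List C)
  chainProduct xss yss = concat (cartesianProductWith (λ xs ys → hooks xs (reverse ys)) xss yss)

  chainProduct-↭ : ∀ xss yss → concat (chainProduct xss yss) ↭ prod (concat xss) (concat yss)
  chainProduct-↭ []         yss = refl
  chainProduct-↭ (xs ∷ xss) yss = ↭-trans
    (↭-reflexive (trans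
      (cong concat (sym (concat-++ (map (λ ys → hooks xs (reverse ys)) yss) _)))
      (sym (concat-++ (concat (map (λ ys → hooks xs (reverse ys)) yss)) (chainProduct xss yss)))))
    (↭-trans (++⁺ (row yss) (chainProduct-↭ xss yss))
      (↭-reflexive (sym (cartesianProductWith-distribʳ-++ f xs (concat xss) (concat yss)))))
    where
    row : ∀ yss → concat (concat (map (λ ys → hooks xs (reverse ys)) yss)) ↭ prod xs (concat yss)
    row []         = ↭-reflexive (sym (cartesianProductWith-zeroʳ f xs))
    row (ys ∷ yss) = ↭-trans (↭-reflexive (sym (concat-++ (hooks xs (reverse ys)) _)))
      (↭-trans (++⁺ (↭-trans (hooks-↭ xs (reverse ys)) (prod-↭ʳ xs (↭-reverse ys))) (row yss))
        (↭-sym (prod-++ʳ xs ys (concat yss))))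

-- Forests, their ranks and their words

data Tree : Set where
  leaf : Tree
  node : Tree → Tree → Tree

size : Tree → ℕ
size leaf       = 0
size (node X Q) = suc (size X + size Q)

nonleaf : Tree → Bool
nonleaf leaf       = false
nonleaf (node _ _) = true

bit : Bool → ℕ
bit false = 0
bit true  = 1

-- In terms of forests, rk counts the internal vertices and word marks them in preorder.
rk : Tree → ℕ
rk leaf       = 0
rk (node X Q) = bit (nonleaf X) + rk X + rk Q

word : Tree → List Bool
word leaf       = []
word (node X Q) = nonleaf X ∷ word X ++ word Q

_⊑_ : Rel Tree 0ℓ
s ⊑ t = Pointwise Bool._≤_ (word s) (word t)

⊑-refl : ∀ {t} → t ⊑ t
⊑-refl = Pointwise.refl Bool.≤-refl

nonleaf-mono : ∀ {s t} → s ⊑ t → nonleaf s Bool.≤ nonleaf t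
nonleaf-mono {leaf}     {leaf}     _ = Bool.b≤b
nonleaf-mono {node _ _} {node _ _} _ = Bool.b≤b

node-mono : ∀ {X X′ Q Q′} → X ⊑ X′ → Q ⊑ Q′ → node X Q ⊑ node X′ Q′
node-mono {X} {X′} x q = nonleaf-mono {X} {X′} x ∷ Pointwise.++⁺ x q

-- The two words are `false ∷ word s` and `nonleaf t ∷ word t`.
node-swap : ∀ {s t} → s ⊑ t → node leaf s ⊑ node t leaf
node-swap {s} {t} s⊑t rewrite ++-identityʳ (word t) = Bool.≤-minimum (nonleaf t) ∷ s⊑t

node-injective : ∀ {X X′ Q Q′} → node X Q ≡ node X′ Q′ → X ≡ X′ × Q ≡ Q′
node-injective refl = refl , refl

size≡suc⇒nonleaf : ∀ {t m} → size t ≡ suc m → nonleaf t ≡ true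
size≡suc⇒nonleaf {node _ _} _ = refl

rk-node : ∀ X Q → nonleaf X ≡ true → rk (node X Q) ≡ suc (rk X) + rk Q
rk-node X Q e rewrite e = refl

-- The path on `m + 1` vertices, all internal except the last: a witness for the top rank `m`.
comb : ℕ → Tree
comb zero    = node leaf leaf
comb (suc m) = node (comb m) leaf

size-comb : ∀ m → size (comb m) ≡ suc m
size-comb zero    = refl
size-comb (suc m) = cong suc (trans (+-identityʳ _) (size-comb m))

rk-comb : ∀ m → rk (comb m) ≡ m
rk-comb zero    = refl
rk-comb (suc m) rewrite size≡suc⇒nonleaf {comb m} (size-comb m) = cong suc (trans (+-identityʳ _) (rk-comb m))

open Chains rk _⊑_
open DownChains rk _⊑_

IsNonleaf : Tree → Set
IsNonleaf t = nonleaf t ≡ true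

-- As all `x` are nonempty, the new root adds one to the rank, so the first hook starts at rank
-- `suc a + b` and has one element fewer than `xs` and `ys` together. For the next hook `a` grows by
-- one while both lists lose an element, which preserves the sum `r`.
hooks-symmetric : ∀ {a b xs ys r} → All IsNonleaf xs → Up a xs → Down (b + length ys) ys →
  a + a + length xs + (b + b + length ys) ≡ r → All (SymmetricChain r) (hooks node xs ys)
hooks-symmetric {xs = []}     _ _ _ _ = []
hooks-symmetric {xs = x ∷ xs} {[]} _ _ _ _ = []
hooks-symmetric {a} {b} {x ∷ xs} {y ∷ ys} {r} (nx ∷ nxs) (cons refl x⊑ up) down′ e
  with b + suc (length ys) in eq | down′
... | _ | cons {t} ey ⊑y down =
  (suc a + b , hook , trans length-hook (cong suc e)) ∷
  hooks-symmetric {suc a} {b} nxs up (subst (λ t → Down t ys) t≡ down)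
    (trans (shuffle a b (length xs) (length ys)) e)
  where
  t≡ : t ≡ b + length ys
  t≡ = suc-injective (trans (sym eq) (+-suc b (length ys)))
  left  = map (node x) (y ∷ ys)
  right = map (λ z → node z y) xs
  shuffle : ∀ a b p q → suc a + suc a + p + (b + b + q) ≡ a + a + suc p + (b + b + suc q)
  shuffle = solve-∀
  base : suc a + b + length left ≡ suc a + suc t
  base = trans (cong (suc a + b +_) (length-map (node x) (y ∷ ys)))
    (trans (+-assoc (suc a) b (suc (length ys))) (cong (suc a +_) eq))
  hook : Up (suc a + b) (left ʳ++ right)
  -- The row of `x`, reversed, climbs from rank `suc a + b` to the corner `node x y`; the column of
  -- `y` continues one rank higher.
  hook = Down-ʳ++-Up
    (subst (λ t → Down t left) (sym base)
      (Down-map (node x) (suc a) (λ Q → rk-node x Q nx) (node-mono {x} ⊑-refl) (cons ey ⊑y down)))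
    (subst (λ t → Up t right) (trans (cong (_+ suc a) (cong suc ey)) (trans (+-comm (suc t) (suc a)) (sym base)))
      (Up-map {Q = IsNonleaf} (λ z → node z y) (suc (rk y))
        (λ {z} nz → trans (rk-node z y nz) (cong suc (+-comm (rk z) (rk y))))
        (λ {z} {z′} _ _ _ z⊑z′ → node-mono {z} {z′} {y} z⊑z′ ⊑-refl) nxs up))
    (All.map⁺ (All.map (λ {z} z⊑y → All.map⁺ (All.map (λ {z′} x⊑z′ → node-mono {x} {z′} {z} x⊑z′ z⊑y) x⊑))
      (⊑-refl ∷ ⊑y)))
  length-hook : suc a + b + (suc a + b) + length (left ʳ++ right) ≡ suc (a + a + suc (length xs) + (b + b + suc (length ys)))
  length-hook rewrite length-ʳ++ left {right} | length-map (node x) ys | length-map (λ z → node z y) xs =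
    count a b (length xs) (length ys)
    where
    count : ∀ a b p q → suc a + b + (suc a + b) + (suc q + p) ≡ suc (a + a + suc p + (b + b + suc q))
    count = solve-∀

chainProduct-symmetric : ∀ {p q r xss yss} → suc p + suc q ≡ r → All IsNonleaf (concat xss) →
  All (SymmetricChain p) xss → All (SymmetricChain q) yss → All (SymmetricChain r) (chainProduct node xss yss)
chainProduct-symmetric {yss = yss} _ _  [] _ = []
chainProduct-symmetric {p} {q} {r} {xs ∷ xss} {yss} e nl ((a , up , ea) ∷ xss-sym) yss-sym =
  subst (All (SymmetricChain r)) (concat-++ (map (λ ys → hooks node xs (reverse ys)) yss) _)
    (All.++⁺ (All.concat⁺ (All.map⁺ (All.map row yss-sym)))
      (chainProduct-symmetric e (All.++⁻ʳ xs nl) xss-sym yss-sym))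
  where
  row : ∀ {ys} → SymmetricChain q ys → All (SymmetricChain r) (hooks node xs (reverse ys))
  row {ys} (b , up′ , eb) = hooks-symmetric {a} {b} (All.++⁻ˡ xs nl) up
    (subst (λ l → Down (b + l) (reverse ys)) (sym (length-reverse ys)) (reverse-Up up′))
    (trans (cong₂ (λ k l → k + (b + b + l)) ea (length-reverse ys)) (trans (cong (suc p +_) eb) e))

-- The product of a chain with {0 < 1}, realised as t ↦ node leaf t and t ↦ node t leaf.
double : List Tree → List (List Tree)
double []       = []
double (x ∷ xs) = (node leaf x ∷ map (λ t → node t leaf) (x ∷ xs)) ∷ map (node leaf) xs ∷ []

double-↭ : ∀ xs → concat (double xs) ↭ map (node leaf) xs ++ map (λ t → node t leaf) xs
double-↭ []       = refl
double-↭ (x ∷ xs) = prep _ (↭-trans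
  (++⁺ˡ (map (λ t → node t leaf) (x ∷ xs)) (↭-reflexive (++-identityʳ (map (node leaf) xs))))
  (++-comm (map (λ t → node t leaf) (x ∷ xs)) (map (node leaf) xs)))

doubles-↭ : ∀ xss → concat (concatMap double xss) ↭
                    map (node leaf) (concat xss) ++ map (λ t → node t leaf) (concat xss)
doubles-↭ []         = refl
doubles-↭ (xs ∷ xss)
  rewrite sym (concat-++ (double xs) (concatMap double xss))
        | map-++ (node leaf) xs (concat xss) | map-++ (λ t → node t leaf) xs (concat xss) =
  ↭-trans (++⁺ (double-↭ xs) (doubles-↭ xss))
    (++-interchange (map (node leaf) xs) (map (λ t → node t leaf) xs) _ _)

-- From a chain of length L starting at rank s come one of length L + 1 starting at s and one of
-- length L - 1 starting at s + 1; both are centred half a rank higher.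
double-symmetric : ∀ {m xs} → All IsNonleaf xs → SymmetricChain m xs → All (SymmetricChain (suc m)) (double xs)
double-symmetric {xs = []} _ _ = []
double-symmetric {m} {x ∷ xs} nls@(nl ∷ _) (s , up@(cons e x⊑ up′) , es) =
    ( s
    , cons e (All.map⁺ (node-swap {x} {x} ⊑-refl ∷ All.map (λ {y} → node-swap {x} {y}) x⊑))
        (Up-map {Q = IsNonleaf} (λ t → node t leaf) 1
          (λ {t} nt → trans (rk-node t leaf nt) (+-identityʳ _))
          (λ {t} {t′} _ _ _ t⊑t′ → node-mono {t} {t′} {leaf} t⊑t′ ⊑-refl) nls up)
    , trans (cong (s + s +_) (cong suc (length-map (λ t → node t leaf) (x ∷ xs))))
        (trans (+-suc (s + s) _) (cong suc es)) )
  ∷ ( suc s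
    , Up-map {Q = λ _ → Tree} (node leaf) 0 (λ _ → refl)
        (λ {t} {t′} _ _ _ t⊑t′ → node-mono {leaf} {leaf} {t} {t′} ⊑-refl t⊑t′) (All.universal (λ t → t) xs) up′
    , trans (cong (suc s + suc s +_) (length-map (node leaf) xs))
        (trans (shuffle s (length xs)) (cong suc es)) )
  ∷ []
  where
  shuffle : ∀ s l → suc s + suc s + l ≡ suc (s + s + suc l)
  shuffle = solve-∀

-- Inductive construction of the chain decompositions

record ChainDecomposition (m : ℕ) : Set where
  field
    chains    : List (List Tree)
    sized     : All (λ t → size t ≡ suc m) (concat chains)
    covered   : ∀ t → size t ≡ suc m → t ∈ concat chains
    once      : Unique (concat chains)
    symmetric : All (SymmetricChain m) chains

  trees : List Tree
  trees = concat chains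

  nonleaves : All IsNonleaf trees
  nonleaves = All.map (λ {t} → size≡suc⇒nonleaf {t}) sized

module Step (m : ℕ) (decompose : ∀ {i} → i < suc m → ChainDecomposition i) where
  open ChainDecomposition using (trees)

  D : ChainDecomposition m
  D = decompose (n<1+n m)

  -- The factors have `i + 1` and `m - i` vertices: these are all the ways to write `m + 1` as an
  -- ordered sum of two positive sizes.
  Dˡ Dʳ : ∀ (i : Fin m) → ChainDecomposition _
  Dˡ i = decompose (m<n⇒m<1+n (Fin.toℕ<n i))
  Dʳ i = decompose (s≤s (m∸n≤m m (suc (toℕ i))))

  complement : ∀ (i : Fin m) → suc (toℕ i) + suc (m ∸ suc (toℕ i)) ≡ suc m
  complement i = trans (+-suc (suc (toℕ i)) _) (cong suc (m+[n∸m]≡n (Fin.toℕ<n i)))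

  products : Fin m → List Tree
  products i = cartesianProductWith node (trees (Dˡ i)) (trees (Dʳ i))

  -- The forests `node X Q` with `X` empty, with `Q` empty, and with neither. On `m + 2` vertices
  -- not both can be empty, so the families are disjoint. The new chains rearrange this list, on
  -- which covering and uniqueness are checked.
  candidates : List Tree
  candidates = (map (node leaf) (trees D) ++ map (λ t → node t leaf) (trees D)) ++ concatMap products (allFin m)

  productChains : Fin m → List (List Tree)
  productChains i = chainProduct node (ChainDecomposition.chains (Dˡ i)) (ChainDecomposition.chains (Dʳ i))

  newChains : List (List Tree)
  newChains = concatMap double (ChainDecomposition.chains D) ++ concatMap productChains (allFin m)

  newChains-↭ : concat newChains ↭ candidates
  newChains-↭ = ↭-trans
    (↭-reflexive (sym (concat-++ (concatMap double (ChainDecomposition.chains D)) _)))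
    (++⁺ (doubles-↭ (ChainDecomposition.chains D)) (go (allFin m)))
    where
    go : ∀ is → concat (concatMap productChains is) ↭ concatMap products is
    go []       = refl
    go (i ∷ is) = ↭-trans (↭-reflexive (sym (concat-++ (productChains i) (concatMap productChains is))))
      (++⁺ (chainProduct-↭ node (ChainDecomposition.chains (Dˡ i)) (ChainDecomposition.chains (Dʳ i))) (go is))

  ∈-products⁻ : ∀ i {t} → t ∈ products i →
    ∃ λ X → ∃ λ Q → t ≡ node X Q × size X ≡ suc (toℕ i) × size Q ≡ suc (m ∸ suc (toℕ i))
  ∈-products⁻ i t∈ with ∈-cartesianProductWith⁻ node (trees (Dˡ i)) (trees (Dʳ i)) t∈
  ... | X , Q , X∈ , Q∈ , t≡ =
    X , Q , t≡ , All.lookup (ChainDecomposition.sized (Dˡ i)) X∈ , All.lookup (ChainDecomposition.sized (Dʳ i)) Q∈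

  candidates-sized : All (λ t → size t ≡ suc (suc m)) candidates
  candidates-sized = All.++⁺
    (All.++⁺ (All.map⁺ (All.map (cong suc) (ChainDecomposition.sized D)))
             (All.map⁺ (All.map (λ e → cong suc (trans (+-identityʳ _) e)) (ChainDecomposition.sized D))))
    (All.concat⁺ (All.map⁺ (All.universal (λ i → All.tabulate (row i)) (allFin m))))
    where
    row : ∀ i {t} → t ∈ products i → size t ≡ suc (suc m)
    row i t∈ with ∈-products⁻ i t∈
    ... | X , Q , refl , eX , eQ = cong suc (trans (cong₂ _+_ eX eQ) (complement i))

  candidates-covered : ∀ t → size t ≡ suc (suc m) → t ∈ candidates
  candidates-covered (node leaf Q) e =
    ∈-++⁺ˡ (∈-++⁺ˡ (∈-map⁺ (node leaf) (ChainDecomposition.covered D Q (suc-injective e))))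
  candidates-covered (node X@(node _ _) leaf) e = ∈-++⁺ˡ (∈-++⁺ʳ (map (node leaf) (trees D)) (∈-map⁺ (λ t → node t leaf)
    (ChainDecomposition.covered D X (trans (sym (+-identityʳ _)) (suc-injective e)))))
  candidates-covered (node X@(node A B) Q@(node A′ B′)) e = ∈-++⁺ʳ (map (node leaf) (trees D) ++ map (λ t → node t leaf) (trees D)) (∈-concatMap⁺ products
    (Any.map (λ { refl → ∈-cartesianProductWith⁺ node
      (ChainDecomposition.covered (Dˡ i) X (cong suc (sym toℕi)))
      (ChainDecomposition.covered (Dʳ i) Q (cong suc (trans (sym (m+n∸m≡n a b))
        (cong₂ _∸_ (suc-injective (trans (sym (+-suc (suc a) b)) (suc-injective e))) (cong suc (sym toℕi)))))) })
      (∈-allFin i)))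
    where
    a = size A + size B
    b = size A′ + size B′
    a<m : a < m
    a<m = ≤-trans (m≤m+n (suc a) b) (≤-reflexive (suc-injective (trans (sym (+-suc (suc a) b)) (suc-injective e))))
    i = fromℕ< a<m
    toℕi : toℕ i ≡ a
    toℕi = Fin.toℕ-fromℕ< a<m

  candidates-unique : Unique candidates
  candidates-unique = Unique.++⁺
    (Unique.++⁺ (Unique.map⁺ (proj₂ ∘ node-injective) (ChainDecomposition.once D))
                (Unique.map⁺ (proj₁ ∘ node-injective) (ChainDecomposition.once D)) leaf-first)
    (Unique.concat⁺
      (All.map⁺ (All.universal (λ i → Unique.cartesianProductWith⁺ node node-injective
        (ChainDecomposition.once (Dˡ i)) (ChainDecomposition.once (Dʳ i))) (allFin m)))
      (AllPairs.map⁺ (AllPairs.map (λ i≢j {t} → different-sizes i≢j {t}) (Unique.allFin⁺ m))))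
    no-leaf
    where
    leaf-first : ∀ {t} → ¬ (t ∈ map (node leaf) (trees D) × t ∈ map (λ t → node t leaf) (trees D))
    leaf-first (t∈ , t∈′) with ∈-map⁻ (node leaf) t∈ | ∈-map⁻ (λ t → node t leaf) t∈′
    ... | _ , _ , refl | _ , X∈ , refl with All.lookup (ChainDecomposition.nonleaves D) X∈
    ...   | ()
    different-sizes : ∀ {i j} → i ≢ j → ∀ {t} → ¬ (t ∈ products i × t ∈ products j)
    different-sizes {i} {j} i≢j (t∈i , t∈j) with ∈-products⁻ i t∈i | ∈-products⁻ j t∈j
    ... | _ , _ , refl , eX , _ | _ , _ , refl , eX′ , _ =
      i≢j (Fin.toℕ-injective (suc-injective (trans (sym eX) eX′)))
    no-leaf : ∀ {t} → ¬ (t ∈ map (node leaf) (trees D) ++ map (λ t → node t leaf) (trees D) ×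
                          t ∈ concatMap products (allFin m))
    no-leaf {t} (t∈ , t∈′) with Any.satisfied (∈-concatMap⁻ products {xs = allFin m} t∈′)
    ... | i , t∈i with ∈-products⁻ i t∈i | ∈-++⁻ (map (node leaf) (trees D)) t∈
    ...   | X , Q , refl , eX , eQ | inj₁ t∈ˡ with ∈-map⁻ (node leaf) t∈ˡ
    ...     | _ , _ , refl with eX
    ...       | ()
    no-leaf {t} (t∈ , t∈′) | i , t∈i | X , Q , refl , eX , eQ | inj₂ t∈ʳ with ∈-map⁻ (λ t → node t leaf) t∈ʳ
    ...     | _ , _ , refl with eQ
    ...       | ()

  newChains-symmetric : All (SymmetricChain (suc m)) newChains
  newChains-symmetric = All.++⁺
    (All.concat⁺ (All.map⁺ (All.zipWith (λ (nl , sc) → double-symmetric nl sc)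
      (All.concat⁻ (ChainDecomposition.nonleaves D) , ChainDecomposition.symmetric D))))
    (All.concat⁺ (All.map⁺ (All.universal (λ i → chainProduct-symmetric (complement i)
      (ChainDecomposition.nonleaves (Dˡ i)) (ChainDecomposition.symmetric (Dˡ i))
      (ChainDecomposition.symmetric (Dʳ i))) (allFin m))))

  step : ChainDecomposition (suc m)
  step = record
    { chains    = newChains
    ; sized     = All-resp-↭ (↭-sym newChains-↭) candidates-sized
    ; covered   = λ t e → ∈-resp-↭ (↭-sym newChains-↭) (candidates-covered t e)
    ; once      = Unique-resp-↭ (↭-sym newChains-↭) candidates-unique
    ; symmetric = newChains-symmetric
    }

single : ChainDecomposition 0
single = record
  { chains    = (node leaf leaf ∷ []) ∷ []
  ; sized     = refl ∷ []
  ; covered   = λ { (node leaf leaf) refl → here refl }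
  ; once      = [] ∷ []
  ; symmetric = (0 , cons refl [] [] , refl) ∷ []
  }

decomposition : ∀ m → ChainDecomposition m
decomposition = <-rec ChainDecomposition λ { zero _ → single ; (suc m) rec → Step.step m rec }

-- Permutations avoiding 132

append : Tree → Tree → Tree
append leaf       Q = Q
append (node A B) Q = node A (append B Q)

roots : Tree → ℕ
roots leaf       = 0
roots (node X Q) = suc (roots Q)

-- Counts the roots that remain roots when `detach` deletes the first one and promotes its children.
-- In `permOf` it is the distance of the first value from the largest.
stay : Tree → ℕ
stay leaf       = 0
stay (node X Q) = roots Q

detach : Tree → Tree
detach leaf       = leaf
detach (node X Q) = append X Q

roots-append : ∀ X Q → roots (append X Q) ≡ roots X + roots Q
roots-append leaf       Q = refl
roots-append (node A B) Q = cong suc (roots-append B Q)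

size-append : ∀ X Q → size (append X Q) ≡ size X + size Q
size-append leaf       Q = refl
size-append (node A B) Q = cong suc (trans (cong (size A +_) (size-append B Q)) (sym (+-assoc (size A) _ _)))

rk-append : ∀ X Q → rk (append X Q) ≡ rk X + rk Q
rk-append leaf       Q = refl
rk-append (node A B) Q = trans (cong (bit (nonleaf A) + rk A +_) (rk-append B Q)) (sym (+-assoc (bit (nonleaf A) + rk A) _ _))

word-append : ∀ X Q → word (append X Q) ≡ word X ++ word Q
word-append leaf       Q = refl
word-append (node A B) Q = cong (nonleaf A ∷_)
  (trans (cong (word A ++_) (word-append B Q)) (sym (++-assoc (word A) (word B) (word Q))))

roots≤size : ∀ t → roots t ≤ size t
roots≤size leaf       = z≤n
roots≤size (node X Q) = s≤s (≤-trans (roots≤size Q) (m≤n+m _ _))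

-- Reverses `detach`: the last `k` trees become `Q`, and the others will hang below a new root.
split-roots : ∀ t {k} → k ≤ roots t → ∃ λ X → ∃ λ Q → append X Q ≡ t × roots Q ≡ k
split-roots leaf       z≤n = leaf , leaf , refl , refl
split-roots (node A B) {k} k≤ with k ≟ suc (roots B)
... | yes k≡ = leaf , node A B , refl , sym k≡
... | no  k≢ with split-roots B (≤-pred (≤∧≢⇒< k≤ k≢))
...   | X , Q , refl , e = node A X , Q , refl , e

-- The number of roots of `Q` fixes where the forest is cut; two different cuts would leave
-- different numbers of roots.
append-injective : ∀ X X′ {Q Q′} → append X Q ≡ append X′ Q′ → roots Q ≡ roots Q′ → X ≡ X′ × Q ≡ Q′
append-injective leaf       leaf       e _ = refl , e
append-injective (node A B) (node A′ B′) e r with node-injective e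
... | refl , e′ with append-injective B B′ e′ r
...   | refl , q = refl , q
append-injective leaf (node A B) {Q} {Q′} refl r =
  contradiction (≤-trans (s≤s (m≤n+m (roots Q′) (roots B))) (≤-reflexive (trans (cong suc (sym (roots-append B Q′))) r))) 1+n≰n
append-injective (node A B) leaf {Q} {Q′} refl r =
  contradiction (≤-trans (s≤s (m≤n+m (roots Q) (roots B))) (≤-reflexive (trans (cong suc (sym (roots-append B Q))) (sym r)))) 1+n≰n

roots≤1+stay : ∀ t → roots t ≤ suc (stay t)
roots≤1+stay leaf       = z≤n
roots≤1+stay (node X Q) = ≤-refl

stay≤roots-detach : ∀ t → stay t ≤ roots (detach t)
stay≤roots-detach leaf       = z≤n
stay≤roots-detach (node X Q) = ≤-trans (m≤n+m _ (roots X)) (≤-reflexive (sym (roots-append X Q)))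

-- The first value of the permutation of t exceeds that of the permutation of
-- detach t by the number of children of the first root of t.
permOf : ∀ n → Tree → Permutation′ n
permOf zero    t = Perm.id
permOf (suc n) t = insert zero (fromℕ< (s≤s (m∸n≤m n (stay t)))) (permOf n (detach t))

permOf-zero : ∀ n t → toℕ (permOf (suc n) t ⟨$⟩ʳ zero) ≡ n ∸ stay t
permOf-zero n t = Fin.toℕ-fromℕ< _

<punchIn⇒≤ : ∀ {n} (v : Fin (suc n)) y → v Fin.< punchIn v y → toℕ v ≤ toℕ y
<punchIn⇒≤ zero    y       _       = z≤n
<punchIn⇒≤ (suc v) (suc y) (s≤s h) = s≤s (<punchIn⇒≤ v y h)

≤⇒<punchIn : ∀ {n} (v : Fin (suc n)) y → toℕ v ≤ toℕ y → v Fin.< punchIn v y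
≤⇒<punchIn zero    y       _       = s≤s z≤n
≤⇒<punchIn (suc v) (suc y) (s≤s h) = s≤s (≤⇒<punchIn v y h)

module _ {n} (p : Permutation′ (suc n)) (v : Fin (suc (suc n))) where

  -- If a 132 pattern starts at the new entry, then `p₀ ≤ v ≤ p c < p b` in `p`, so `p` has such a
  -- pattern starting at its own first entry.
  avoids-insert : Avoids132 p → toℕ (p ⟨$⟩ʳ zero) ≤ toℕ v → Avoids132 (insert zero v p)
  avoids-insert av p₀≤v (suc a) (suc b) (suc c) (s≤s a<b) (s≤s b<c) (h , h′) =
    av a b c a<b b<c (punchIn-cancel-< v h , punchIn-cancel-< v h′)
  avoids-insert av p₀≤v zero (suc b) (suc c) _ (s≤s b<c) (h , h′)
    with punchIn-cancel-< v h′ | ≤-trans p₀≤v (<punchIn⇒≤ v _ h)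
  avoids-insert av p₀≤v zero (suc zero) (suc c) _ (s≤s b<c) (h , h′) | c<b | p₀≤c = <⇒≱ c<b p₀≤c
  avoids-insert av p₀≤v zero (suc (suc b)) (suc c) _ (s≤s b<c) (h , h′) | c<b | p₀≤c =
    av zero (suc b) c (s≤s z≤n) b<c
      (Fin.≤∧≢⇒< p₀≤c (λ e → Fin.<⇒≢ (≤-<-trans z≤n b<c) (Injection.injective (↔⇒↣ p) e)) , c<b)

  avoids-tail : Avoids132 (insert zero v p) → Avoids132 p
  avoids-tail av a b c a<b b<c (h , h′) =
    av (suc a) (suc b) (suc c) (s≤s a<b) (s≤s b<c) (punchIn-mono-< v h , punchIn-mono-< v h′)

  -- If v < p₀ then the entry of p equal to v completes a 132 pattern.
  avoids-head : Avoids132 (insert zero v p) → toℕ (p ⟨$⟩ʳ zero) ≤ toℕ v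
  avoids-head av = ≮⇒≥ λ v<p₀ →
    let u    = fromℕ< (<-trans v<p₀ (Fin.toℕ<n (p ⟨$⟩ʳ zero)))
        u≡v  = Fin.toℕ-fromℕ< (<-trans v<p₀ (Fin.toℕ<n (p ⟨$⟩ʳ zero)))
        c    = p ⟨$⟩ˡ u
        pc≡u = Perm.inverseʳ p {u}
        u<p₀ = subst (_< toℕ (p ⟨$⟩ʳ zero)) (sym u≡v) v<p₀
        0<c  = ≤∧≢⇒< z≤n (λ e → <-irrefl (cong toℕ (trans (sym pc≡u) (cong (p ⟨$⟩ʳ_) (sym (Fin.toℕ-injective {j = c} e))))) u<p₀)
    in av zero (suc zero) (suc c) (s≤s z≤n) (s≤s 0<c)
         ( ≤⇒<punchIn v _ (≤-reflexive (trans (sym u≡v) (cong toℕ (sym pc≡u))))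
         , punchIn-mono-< v (subst (Fin._< p ⟨$⟩ʳ zero) (sym pc≡u) u<p₀) )

  Des-insert : Des (insert zero v p) ≡ does (punchIn v (p ⟨$⟩ʳ zero) Fin.<? v) ∷ Des p
  Des-insert = cong (does (punchIn v (p ⟨$⟩ʳ zero) Fin.<? v) ∷_) (Vec.tabulate-cong λ i → does-punchIn-<? v (p ⟨$⟩ʳ suc i) (p ⟨$⟩ʳ Fin.inject₁ i))

permOf-avoids : ∀ n t → Avoids132 (permOf n t)
permOf-avoids zero          t ()
permOf-avoids (suc zero)    t zero zero _ ()
permOf-avoids (suc (suc n)) t = avoids-insert (permOf (suc n) (detach t)) _ (permOf-avoids (suc n) (detach t))
  (subst₂ _≤_ (sym (permOf-zero n (detach t))) (sym (permOf-zero (suc n) t))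
    (∸-monoʳ-≤ (suc n) (≤-trans (stay≤roots-detach t) (roots≤1+stay (detach t)))))

avoiderOf : ∀ n → Tree → AvoidingPermutation n
avoiderOf n t = avp (permOf n t) (permOf-avoids n t)

size-detach : ∀ t {n} → size t ≡ suc n → size (detach t) ≡ n
size-detach (node X Q) e = trans (size-append X Q) (suc-injective e)

-- The later values determine `append X Q` by induction. The first value determines `roots Q`, the
-- subtraction not being truncated, and hence the cut.
permOf-injective : ∀ n {s t} → size s ≡ n → size t ≡ n → permOf n s Perm.≈ permOf n t → s ≡ t
permOf-injective zero {leaf} {leaf} _ _ _ = refl
permOf-injective (suc n) {s@(node X Q)} {t@(node X′ Q′)} es et e
  with insert-injective {p = permOf n (append X Q)} {permOf n (append X′ Q′)} e
... | v≡ , e′ with append-injective X X′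
      (permOf-injective n (size-detach s es) (size-detach t et) e′)
      (∸-cancelˡ-≡ (≤-trans (roots≤size Q) (≤-trans (m≤n+m _ (size X)) (≤-reflexive (suc-injective es))))
                   (≤-trans (roots≤size Q′) (≤-trans (m≤n+m _ (size X′)) (≤-reflexive (suc-injective et))))
        (trans (sym (permOf-zero n s)) (trans (cong toℕ v≡) (permOf-zero n t))))
...   | refl , refl = refl

avoids-reinsert : ∀ {n} (p : Permutation′ (suc n)) → Avoids132 p →
                  Avoids132 (insert zero (p ⟨$⟩ʳ zero) (remove zero p))
avoids-reinsert p = Avoids132-resp {p = p} {q = insert zero (p ⟨$⟩ʳ zero) (remove zero p)}
  (sym ∘ Perm.insert-remove zero p)

insert-zero-cong : ∀ {n j k} {p q : Permutation′ n} → j ≡ k → p Perm.≈ q → insert zero j p Perm.≈ insert zero k q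
insert-zero-cong {j = j} {p = p} {q} refl = insert-cong {i = zero} {j} {p} {q}

-- Without its first value `v` the permutation comes from a forest `t′`. Keeping the last
-- `suc n - v` trees of `t′` as `Q` and putting the others below a new root yields the first value
-- `v`.
permOf-surjective : ∀ n (p : Permutation′ n) → Avoids132 p → ∃ λ t → size t ≡ n × permOf n t Perm.≈ p
permOf-surjective zero p av = leaf , refl , λ ()
permOf-surjective (suc zero) p av = node leaf leaf , refl , λ { zero → Fin.toℕ-injective (sym (n<1⇒n≡0 (Fin.toℕ<n (p ⟨$⟩ʳ zero)))) }
permOf-surjective (suc (suc n)) p av
  with permOf-surjective (suc n) (remove zero p) (avoids-tail (remove zero p) (p ⟨$⟩ʳ zero) (avoids-reinsert p av))
... | t′@(node A B) , st , e with split-roots t′ k≤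
  where
  v = p ⟨$⟩ʳ zero
  -- Avoidance bounds `v` from below by the first value of the rest, so `t′` has enough trees.
  n∸≤v : n ∸ roots B ≤ toℕ v
  n∸≤v = subst (_≤ toℕ v) (trans (cong toℕ (sym (e zero))) (permOf-zero n t′)) (avoids-head (remove zero p) v (avoids-reinsert p av))
  k≤ : suc n ∸ toℕ v ≤ suc (roots B)
  k≤ = m≤n+o⇒m∸n≤o (suc n) (toℕ v) (≤-trans (s≤s (m≤n+m∸n n (roots B)))
    (≤-trans (s≤s (+-monoʳ-≤ (roots B) n∸≤v)) (≤-reflexive (+-comm (suc (roots B)) (toℕ v)))))
...   | X , Q , split , rQ = node X Q
  , cong suc (trans (sym (size-append X Q)) (trans (cong size split) st))
  , λ i → trans (insert-zero-cong {p = permOf (suc n) (append X Q)} {remove zero p} v≡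
      (subst (λ t → permOf (suc n) t Perm.≈ remove zero p) (sym split) e) i) (Perm.insert-remove zero p i)
  where
  v≡ : fromℕ< (s≤s (m∸n≤m (suc n) (roots Q))) ≡ p ⟨$⟩ʳ zero
  v≡ = Fin.toℕ-injective (trans (Fin.toℕ-fromℕ< _) (trans (cong (suc n ∸_) rQ) (m∸[m∸n]≡n (≤-pred (Fin.toℕ<n (p ⟨$⟩ʳ zero))))))

head-descent : ∀ {n} (p : Permutation′ (suc n)) v {b} →
  (b ≡ true → toℕ (p ⟨$⟩ʳ zero) < toℕ v) → (b ≡ false → toℕ v ≤ toℕ (p ⟨$⟩ʳ zero)) →
  does (punchIn v (p ⟨$⟩ʳ zero) Fin.<? v) ≡ b
head-descent p v {true}  below _ = dec-true (punchIn v (p ⟨$⟩ʳ zero) Fin.<? v)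
  (Fin.≤∧≢⇒< (≮⇒≥ λ h → <⇒≱ (below refl) (<punchIn⇒≤ v _ h)) (Fin.punchInᵢ≢i v _))
head-descent p v {false} _ above = dec-false (punchIn v (p ⟨$⟩ʳ zero) Fin.<? v)
  (<⇒≯ (≤⇒<punchIn v _ (above refl)))

-- The first values of the two permutations differ by `roots X`, which is positive exactly when `X`
-- is nonempty; exactly then the inserted value exceeds its successor.
Des-permOf : ∀ n X Q → size (node X Q) ≡ suc (suc n) →
  Des (permOf (suc (suc n)) (node X Q)) ≡ nonleaf X ∷ Des (permOf (suc n) (append X Q))
Des-permOf n X Q e = trans (Des-insert p v) (cong (_∷ Des p)
  (head-descent p v (λ nl → subst₂ _<_ (sym p₀≡) (sym v≡) (rises X nl (suc-injective e)))
                    (λ nl → subst₂ _≤_ (sym v≡) (sym p₀≡) (stays X Q nl (suc-injective e)))))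
  where
  p = permOf (suc n) (append X Q)
  v = fromℕ< (s≤s (m∸n≤m (suc n) (roots Q)))
  v≡ = Fin.toℕ-fromℕ< (s≤s (m∸n≤m (suc n) (roots Q)))
  p₀≡ = permOf-zero n (append X Q)
  rises : ∀ X → nonleaf X ≡ true → size X + size Q ≡ suc n → n ∸ stay (append X Q) < suc n ∸ roots Q
  rises (node A B) _ e = subst (n ∸ roots (append B Q) <_)
    (sym (+-∸-assoc 1 (≤-trans (roots≤size Q) (≤-trans (m≤n+m _ _) (≤-reflexive (suc-injective e))))))
    (s≤s (∸-monoʳ-≤ n (≤-trans (m≤n+m _ (roots B)) (≤-reflexive (sym (roots-append B Q))))))
  stays : ∀ X Q → nonleaf X ≡ false → size X + size Q ≡ suc n → suc n ∸ roots Q ≤ n ∸ stay (append X Q)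
  stays leaf (node _ _) _ _ = ≤-refl

∣Des-avoiderOf∣ : ∀ n t → size t ≡ n → ∣ Des (permOf n t) ∣ ≡ rk t
∣Des-avoiderOf∣ zero          leaf             _ = refl
∣Des-avoiderOf∣ (suc zero)    (node leaf leaf) _ = refl
∣Des-avoiderOf∣ (suc (suc n)) (node X Q)       e = trans (cong ∣_∣ (Des-permOf n X Q e))
  (trans (∣∷∣ (nonleaf X) (Des (permOf (suc n) (append X Q)))) (trans (cong (bit (nonleaf X) +_)
    (trans (∣Des-avoiderOf∣ (suc n) (append X Q) (size-detach (node X Q) e)) (rk-append X Q)))
    (sym (+-assoc (bit (nonleaf X)) (rk X) (rk Q)))))
  where
  ∣∷∣ : ∀ b {k} (p : Subset k) → ∣ b ∷ p ∣ ≡ bit b + ∣ p ∣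
  ∣∷∣ false p = refl
  ∣∷∣ true  p = refl

-- By `word-append`, `detach` drops the first mark of the word, as removing the first value drops
-- the first position of the descent set. Hence the descent set is the word without its last mark,
-- which belongs to a leaf.
Des-mono : ∀ n s t → size s ≡ n → size t ≡ n → s ⊑ t → Des (permOf n s) ⊆ Des (permOf n t)
Des-mono zero       _ _ _ _ _ = λ h → h
Des-mono (suc zero) _ _ _ _ _ = λ ()
Des-mono (suc (suc n)) (node X Q) (node X′ Q′) e e′ (b≤b′ ∷ ws) =
  subst₂ _⊆_ (sym (Des-permOf n X Q e)) (sym (Des-permOf n X′ Q′ e′)) (cons-⊆ b≤b′
    (Des-mono (suc n) (append X Q) (append X′ Q′) (size-detach (node X Q) e) (size-detach (node X′ Q′) e′)
      (subst₂ (Pointwise Bool._≤_) (sym (word-append X Q)) (sym (word-append X′ Q′)) ws)))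
  where
  cons-⊆ : ∀ {k b c} {p q : Subset k} → b Bool.≤ c → p ⊆ q → b ∷ p ⊆ c ∷ q
  cons-⊆ Bool.f≤t p⊆q = Subset.out⊆ p⊆q
  cons-⊆ Bool.b≤b p⊆q = Subset.s⊆s p⊆q

⊆∧∣∣<⇒⊂ : ∀ {n} {p q : Subset n} → p ⊆ q → ∣ p ∣ < ∣ q ∣ → p ⊂ q
⊆∧∣∣<⇒⊂ {p = p} {q} p⊆q ∣p∣<∣q∣ with Fin.any? (λ x → (x Subset.∈? q) ×-dec ¬? (x Subset.∈? p))
... | yes extra = p⊆q , extra
... | no  none  = contradiction (Subset.p⊆q⇒∣p∣≤∣q∣ q⊆p) (<⇒≱ ∣p∣<∣q∣)
  where
  q⊆p : q ⊆ p
  q⊆p {x} x∈q with x Subset.∈? p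
  ... | yes x∈p = x∈p
  ... | no  x∉p = contradiction (x , x∈q , x∉p) none

-- Transport of the chains to avoiding permutations

module _ {m : ℕ} (D : ChainDecomposition m) where
  open ChainDecomposition D
  open RankedPoset (Pᴬ (suc m)) using (Carrier; _≼_; rank; _∈≈_; Unique≈)
  private
    f = avoiderOf (suc m)

  Pᴬ-enumerated : ∀ p → p ∈≈ map f trees
  Pᴬ-enumerated (avp p av) with permOf-surjective (suc m) p av
  ... | t , st , e = Any.map⁺ (Any.map (λ { refl i → sym (e i) }) (covered t st))

  Pᴬ-once : Unique≈ (map f trees)
  Pᴬ-once = AllPairs.map⁺ (AllPairs-zip sized once)
    where
    AllPairs-zip : ∀ {ts} → All (λ t → size t ≡ suc m) ts → Unique ts →
                   AllPairs (λ s t → ¬ permOf (suc m) s Perm.≈ permOf (suc m) t) ts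
    AllPairs-zip [] [] = []
    AllPairs-zip (es ∷ ss) (s∉ ∷ ts!) =
      All.zipWith (λ (et , s≢t) → s≢t ∘ permOf-injective (suc m) es et) (ss , s∉) ∷ AllPairs-zip ss ts!

  Pᴬ-symmetric : All (Chains.SymmetricChain rank _≼_ m) (map (map f) chains)
  Pᴬ-symmetric = All.map⁺ (All.zipWith (λ { {xs} (ss , s , up , e) →
      s , Up-map f 0 (λ {t} → ∣Des-avoiderOf∣ (suc m) t) mono ss up
        , trans (cong (s + s +_) (length-map f xs)) e }) (All.concat⁻ sized , symmetric))
    where
    mono : ∀ {s t} → size s ≡ suc m → size t ≡ suc m → rk s < rk t → s ⊑ t → f s ≼ f t
    mono {s} {t} es et s<t s⊑t = inj₁ (⊆∧∣∣<⇒⊂ (Des-mono (suc m) s t es et s⊑t)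
      (subst₂ _<_ (sym (∣Des-avoiderOf∣ (suc m) s es)) (sym (∣Des-avoiderOf∣ (suc m) t et)) s<t))

  Pᴬ-rank-strict : ∀ p q → p ≼ q → rank p ≡ rank q → RankedPoset._≈_ (Pᴬ (suc m)) p q
  Pᴬ-rank-strict p q (inj₁ p<q) e = contradiction e (<⇒≢ (Subset.p⊂q⇒∣p∣<∣q∣ p<q))
  Pᴬ-rank-strict p q (inj₂ p≈q) _ = p≈q

  Pᴬ-top : ∃ λ p → rank p ≡ m
  Pᴬ-top = f (comb m) , trans (∣Des-avoiderOf∣ (suc m) (comb m) (size-comb m)) (rk-comb m)

  private
    maps≡ : concat (map (map f) chains) ≡ map f trees
    maps≡ = concat-map chains

  module Pᴬ-decomposition = SymmetricChainDecomposition (Pᴬ (suc m)) Pᴬ-rank-strict m Pᴬ-top (map (map f) chains)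
    (λ p → subst (p ∈≈_) (sym maps≡) (Pᴬ-enumerated p)) (subst Unique≈ (sym maps≡) Pᴬ-once) Pᴬ-symmetric

  Pᴬ-rankSize : ∀ k → rankSize (Pᴬ (suc m)) k ≡ level rk k trees
  Pᴬ-rankSize k = trans (rankSize-enumeration (Pᴬ (suc m)) Pᴬ-once Pᴬ-enumerated k)
    (level-map rank rk f k (All.map (λ {t} → ∣Des-avoiderOf∣ (suc m) t) sized))

-- Noncrossing partitions

open Equivalence using (to; from)

-- The number of leaves of a tree with `X` below its root, the second argument being `leaves X`. It
-- counts the blocks on 0, ..., `size X`: 0 is alone if `X` is empty and joins a block of `X`
-- otherwise.
rootLeaves : Tree → ℕ → ℕ
rootLeaves leaf       _ = 1
rootLeaves (node _ _) k = k

leaves : Tree → ℕ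
leaves leaf       = 0
leaves (node X Q) = rootLeaves X (leaves X) + leaves Q

-- Every vertex is a leaf or internal. As blocks will correspond to leaves, the rank `n - bk` of the
-- coded partition is `rk`.
leaves+rk : ∀ t → leaves t + rk t ≡ size t
leaves+rk leaf                   = refl
leaves+rk (node leaf Q)          = cong suc (leaves+rk Q)
leaves+rk (node X@(node A B) Q) = trans (shuffle (leaves X) (leaves Q) (rk X) (rk Q))
  (cong suc (cong₂ _+_ (leaves+rk X) (leaves+rk Q)))
  where
  shuffle : ∀ a b c d → a + b + (suc c + d) ≡ suc (a + c + (b + d))
  shuffle = solve-∀

-- Numbers up to `s` are shifted down to the positions of `X`, and 0 shares the position of `s`. For
-- `s = 0` the value 0 is a harmless default, since `leaf` labels everything alike.
tuck : ℕ → ℕ → ℕ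
tuck s zero    = pred s
tuck s (suc x) = x

-- The noncrossing partition of node X Q on 0, …, size X + size Q: the partition of X
-- on 1, …, size X, that of Q on the remaining numbers, and 0 in the block of the
-- number size X (alone if X = leaf).
label : Tree → ℕ → ℕ
label leaf       x = 0
label (node X Q) x with x ≤? size X
... | yes _ = label X (tuck (size X) x)
... | no  _ = rootLeaves X (leaves X) + label Q (x ∸ suc (size X))

label-low : ∀ X Q {x} → x ≤ size X → label (node X Q) x ≡ label X (tuck (size X) x)
label-low X Q {x} x≤ with x ≤? size X
... | yes _  = refl
... | no  x≰ = contradiction x≤ x≰

label-high : ∀ X Q y {x} → x ≡ suc (size X) + y → label (node X Q) x ≡ rootLeaves X (leaves X) + label Q y
label-high X Q y refl with suc (size X) + y ≤? size X
... | yes h = contradiction (≤-trans (m≤m+n (suc (size X)) y) h) 1+n≰n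
... | no  _ = cong (λ z → rootLeaves X (leaves X) + label Q z) (m+n∸m≡n (suc (size X)) y)

data Side (s x : ℕ) : Set where
  low  : x ≤ s → Side s x
  high : ∀ y → x ≡ suc s + y → Side s x

side : ∀ s x → Side s x
side s x with x ≤? s
... | yes x≤s = low x≤s
... | no  x≰s = high (x ∸ suc s) (sym (m+[n∸m]≡n (≰⇒> x≰s)))

label-<     : ∀ t {x} → x < size t → label t x < leaves t
label-low-< : ∀ X {x} → x ≤ size X → label X (tuck (size X) x) < rootLeaves X (leaves X)

label-< (node X Q) {x} x< with side (size X) x
... | low x≤     = subst (_< leaves (node X Q)) (sym (label-low X Q x≤)) (≤-trans (label-low-< X x≤) (m≤m+n _ _))
... | high y refl = subst (_< leaves (node X Q)) (sym (label-high X Q y refl))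
  (+-monoʳ-< (rootLeaves X (leaves X)) (label-< Q (+-cancelˡ-< (suc (size X)) _ _ x<)))

label-low-< leaf       _ = s≤s z≤n
label-low-< X@(node _ _) {zero}  x≤ = label-< X ≤-refl
label-low-< X@(node _ _) {suc x} x≤ = label-< X x≤

label-surjective : ∀ t {c} → c < leaves t → ∃ λ x → x < size t × label t x ≡ c
label-surjective (node X Q) {c} c< with c <? rootLeaves X (leaves X)
... | no c≮ with label-surjective Q (+-cancelˡ-< (rootLeaves X (leaves X)) _ _
                   (subst (_< leaves (node X Q)) (sym (m+[n∸m]≡n (≮⇒≥ c≮))) c<))
...   | y , y< , e = suc (size X) + y , +-monoʳ-< (suc (size X)) y<
                   , trans (label-high X Q y refl) (trans (cong (rootLeaves X (leaves X) +_) e) (m+[n∸m]≡n (≮⇒≥ c≮)))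
label-surjective (node leaf Q) {zero} c< | yes _ = 0 , s≤s z≤n , refl
label-surjective (node leaf Q) {suc c} c< | yes (s≤s ())
label-surjective (node X@(node _ _) Q) c< | yes c<′ with label-surjective X c<′
... | x , x< , e = suc x , s≤s (≤-trans x< (m≤m+n _ _)) , trans (label-low X Q x<) e

-- The labels on 0, ..., `size X` are below `rootLeaves X (leaves X)` and all later ones are not, so
-- no block meets both parts.
low-closed : ∀ X Q {x y} → x ≤ size X → label (node X Q) x ≡ label (node X Q) y → y ≤ size X
low-closed X Q {x} {y} x≤ e with side (size X) y
... | low y≤      = y≤
... | high z refl = contradiction (label-low-< X x≤) (≤⇒≯ (≤-trans (m≤m+n _ (label Q z))
  (≤-reflexive (trans (sym (label-high X Q z refl)) (trans (sym e) (label-low X Q x≤))))))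

label-0 : ∀ X Q → label (node X Q) 0 ≡ label (node X Q) (size X)
label-0 leaf         Q = refl
label-0 X@(node _ _) Q = trans (label-low X Q {0} z≤n) (sym (label-low X Q ≤-refl))

module _ {A : Set} where

  -- Partitions of {0, ..., n - 1} are handled as kernels of functions with arbitrary labels;
  -- `SameKernel` is equality of the partitions.
  NoncrossingBelow : ℕ → (ℕ → A) → Set
  NoncrossingBelow n l = ∀ {a b c d} → a < b → b < c → c < d → d < n → l a ≡ l c → l b ≡ l d → l a ≡ l b

  SameKernel : {B : Set} → ℕ → (ℕ → A) → (ℕ → B) → Set
  SameKernel n l l′ = ∀ {x y} → x < n → y < n → l x ≡ l y ⇔ l′ x ≡ l′ y

SameKernel-sym : {A B : Set} {l : ℕ → A} {l′ : ℕ → B} → ∀ {n n′} → n ≡ n′ → SameKernel n l l′ → SameKernel n′ l′ l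
SameKernel-sym refl same x< y< = mk⇔ (from (same x< y<)) (to (same x< y<))

-- In a crossing that starts at 0, the mate `size X` of 0 can take its place at the far end, giving
-- a crossing inside `X`, unless `d` is that mate already.
low-noncrossing : ∀ X → NoncrossingBelow (size X) (label X) →
                  NoncrossingBelow (suc (size X)) (label X ∘ tuck (size X))
low-noncrossing X nc {suc a} {suc b} {suc c} {suc d} (s≤s a<b) (s≤s b<c) (s≤s c<d) (s≤s d<) = nc a<b b<c c<d d<
low-noncrossing X@(node _ _) nc {zero} {suc b} {suc c} {suc d} _ (s≤s b<c) (s≤s c<d) (s≤s (s≤s d≤)) 0~c b~d
  with m≤n⇒m<n∨m≡n d≤
... | inj₂ refl   = sym b~d
... | inj₁ d<last = trans 0~c (sym (nc b<c c<d d<last ≤-refl b~d (sym 0~c)))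

label-low-≡ : ∀ X Q {x y} → x ≤ size X → y ≤ size X →
  label (node X Q) x ≡ label (node X Q) y ⇔ label X (tuck (size X) x) ≡ label X (tuck (size X) y)
label-low-≡ X Q x≤ y≤ = mk⇔ (λ e → trans (sym (label-low X Q x≤)) (trans e (label-low X Q y≤)))
                            (λ e → trans (label-low X Q x≤) (trans e (sym (label-low X Q y≤))))

label-high-≡ : ∀ X Q {x y x′ y′} → x ≡ suc (size X) + x′ → y ≡ suc (size X) + y′ →
  label (node X Q) x ≡ label (node X Q) y ⇔ label Q x′ ≡ label Q y′
label-high-≡ X Q {x′ = x′} {y′} x≡ y≡ = mk⇔
  (λ e → +-cancelˡ-≡ (rootLeaves X (leaves X)) _ _ (trans (sym (label-high X Q x′ x≡)) (trans e (label-high X Q y′ y≡))))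
  (λ e → trans (label-high X Q x′ x≡) (trans (cong (rootLeaves X (leaves X) +_) e) (sym (label-high X Q y′ y≡))))

label-noncrossing : ∀ t → NoncrossingBelow (size t) (label t)
label-noncrossing (node X Q) {a} {b} {c} {d} a<b b<c c<d d< a~c b~d with side (size X) a
... | low a≤ = from (label-low-≡ X Q a≤ b≤)
  (low-noncrossing X (label-noncrossing X) a<b b<c c<d (s≤s d≤)
    (to (label-low-≡ X Q a≤ c≤) a~c) (to (label-low-≡ X Q b≤ d≤) b~d))
  where
  -- Being low passes along the blocks from `a` to `c` and from `b` to `d`, and by order from `c` to
  -- `b`.
  c≤ = low-closed X Q a≤ a~c
  b≤ = ≤-trans (<⇒≤ b<c) c≤
  d≤ = low-closed X Q b≤ b~d
... | high a′ refl with side (size X) b | side (size X) c | side (size X) d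
...   | high b′ refl | high c′ refl | high d′ refl = from (label-high-≡ X Q refl refl)
  (label-noncrossing Q (+-cancelˡ-< s _ _ a<b) (+-cancelˡ-< s _ _ b<c) (+-cancelˡ-< s _ _ c<d) (+-cancelˡ-< s _ _ d<)
    (to (label-high-≡ X Q refl refl) a~c) (to (label-high-≡ X Q refl refl) b~d))
  where s = suc (size X)
...   | low b≤ | _ | _ = contradiction (≤-trans (m≤m+n _ a′) (≤-trans (<⇒≤ a<b) b≤)) 1+n≰n
...   | _ | low c≤ | _ = contradiction (≤-trans (m≤m+n _ a′) (≤-trans (<⇒≤ (<-trans a<b b<c)) c≤)) 1+n≰n
...   | _ | _ | low d≤ = contradiction (≤-trans (m≤m+n _ a′) (≤-trans (<⇒≤ (<-trans a<b (<-trans b<c c<d))) d≤)) 1+n≰n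

-- The number `size X′` shares a block with 0 in both partitions, and in the first one no number
-- beyond `size X` does.
last-block-mate : ∀ X Q X′ Q′ → size (node X Q) ≡ size (node X′ Q′) →
  SameKernel (size (node X Q)) (label (node X Q)) (label (node X′ Q′)) → size X′ ≤ size X
last-block-mate X Q X′ Q′ e same = low-closed X Q z≤n
  (from (same (s≤s z≤n) (subst (size X′ <_) (sym e) (s≤s (m≤m+n _ _)))) (label-0 X′ Q′))

-- The largest number in the block of 0 recovers the cut, after which the kernels restrict to the
-- two parts.
label-injective : ∀ s t → size s ≡ size t → SameKernel (size s) (label s) (label t) → s ≡ t
label-injective leaf       leaf         _ _    = refl
label-injective (node X Q) (node X′ Q′) e same = cong₂ node
  (label-injective X X′ X≡X′ λ x< y< →
    mk⇔ (to (low′ x< y<) ∘ to (same′ x< y<) ∘ from (low″ x< y<))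
        (to (low″ x< y<) ∘ from (same′ x< y<) ∘ from (low′ x< y<)))
  (label-injective Q Q′ Q≡Q′ λ x< y< →
    mk⇔ (to high′ ∘ to (same (+-monoʳ-< s x<) (+-monoʳ-< s y<)) ∘ from (label-high-≡ X Q refl refl))
        (to (label-high-≡ X Q refl refl) ∘ from (same (+-monoʳ-< s x<) (+-monoʳ-< s y<)) ∘ from high′))
  where
  s = suc (size X)
  X≡X′ : size X ≡ size X′
  X≡X′ = ≤-antisym
    (last-block-mate X′ Q′ X Q (sym e) (SameKernel-sym e same))
    (last-block-mate X Q X′ Q′ e same)
  Q≡Q′ : size Q ≡ size Q′
  Q≡Q′ = +-cancelˡ-≡ (size X) _ _ (trans (suc-injective e) (cong (_+ size Q′) (sym X≡X′)))
  low″ : ∀ {x y} → x < size X → y < size X → _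
  low″ {x} {y} x< y< = label-low-≡ X Q {suc x} {suc y} x< y<
  low′ : ∀ {x y} → x < size X → y < size X → _
  low′ {x} {y} x< y< = label-low-≡ X′ Q′ {suc x} {suc y} (subst (x <_) X≡X′ x<) (subst (y <_) X≡X′ y<)
  same′ : ∀ {x y} → x < size X → y < size X → _
  same′ {x} {y} x< y< = same {suc x} {suc y} (s≤s (≤-trans x< (m≤m+n _ _))) (s≤s (≤-trans y< (m≤m+n _ _)))
  high′ : ∀ {x y} → label (node X′ Q′) (s + x) ≡ label (node X′ Q′) (s + y) ⇔ label Q′ x ≡ label Q′ y
  high′ {x} {y} = label-high-≡ X′ Q′ (cong (λ k → suc k + x) X≡X′) (cong (λ k → suc k + y) X≡X′)

-- Decoding a noncrossing partition into a forest

last-index : ∀ m {P : ℕ → Set} → (∀ x → Dec (P x)) → P 0 →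
             ∃ λ i → i ≤ m × P i × (∀ {x} → i < x → x ≤ m → ¬ P x)
last-index zero    P? p = 0 , z≤n , p , λ 0<x x≤0 _ → <⇒≱ 0<x x≤0
last-index (suc m) P? p with P? (suc m) | last-index m P? p
... | yes q | _ = suc m , ≤-refl , q , λ m< ≤m _ → <⇒≱ m< ≤m
... | no ¬q | i , i≤m , pi , none = i , m≤n⇒m≤1+n i≤m , pi , λ i<x x≤ → beyond i<x (m≤n⇒m<n∨m≡n x≤)
  where
  beyond : ∀ {x} → i < x → x < suc m ⊎ x ≡ suc m → ¬ _
  beyond i<x (inj₁ (s≤s x≤m)) = none i<x x≤m
  beyond i<x (inj₂ refl)      = ¬q

module _ {A : Set} (_≟ᴬ_ : DecidableEquality A) where

  decode-node : ∀ m (l : ℕ → A) → NoncrossingBelow (suc m) l → ∀ i → i ≤ m → l 0 ≡ l i →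
    (∀ {x} → i < x → x ≤ m → l 0 ≢ l x) →
    (∃ λ X → size X ≡ i × SameKernel i (label X) (l ∘ suc)) →
    (∃ λ Q → size Q ≡ m ∸ i × SameKernel (m ∸ i) (label Q) (λ x → l (suc i + x))) →
    ∃ λ t → size t ≡ suc m × SameKernel (suc m) (label t) l
  decode-node m l nc i i≤m 0~i none (X , refl , X~) (Q , Q≡ , Q~) =
    node X Q , cong suc total , λ {x} {y} x< y< → kernel x< y< (side i x) (side i y)
    where
    total : i + size Q ≡ m
    total = trans (cong (i +_) Q≡) (m+[n∸m]≡n i≤m)
    -- If `0 < x < i < y` and `x`, `y` share a block, noncrossing with the pair 0, `i` puts `y` in
    -- the block of 0, beyond its largest member `i`.
    separated : ∀ {x y} → x ≤ i → i < y → y ≤ m → l x ≢ l y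
    separated {zero}  _  i<y y≤m e = none i<y y≤m e
    separated {suc x} x≤ i<y y≤m e with m≤n⇒m<n∨m≡n x≤
    ... | inj₂ x≡i = none i<y y≤m (trans 0~i (trans (cong l (sym x≡i)) e))
    ... | inj₁ x<i  = none i<y y≤m (trans (nc (s≤s z≤n) x<i i<y (s≤s y≤m) 0~i e) e)
    rest : ∀ {x} → suc i + x < suc m → x < m ∸ i
    rest {x} h = +-cancelˡ-< i _ _ (subst (i + x <_) (sym (m+[n∸m]≡n i≤m)) (≤-pred h))
    low-kernel : ∀ X → SameKernel (size X) (label X) (l ∘ suc) → l 0 ≡ l (size X) → ∀ {x y} → x ≤ size X → y ≤ size X →
      label X (tuck (size X) x) ≡ label X (tuck (size X) y) ⇔ l x ≡ l y
    low-kernel leaf _ _ z≤n z≤n = mk⇔ (λ _ → refl) (λ _ → refl)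
    low-kernel X@(node _ _) X~ 0~ {zero}  {zero}  _  _  = mk⇔ (λ _ → refl) (λ _ → refl)
    low-kernel X@(node _ _) X~ 0~ {zero}  {suc y} _  y≤ = mk⇔ (trans 0~ ∘ to (X~ ≤-refl y≤)) (from (X~ ≤-refl y≤) ∘ trans (sym 0~))
    low-kernel X@(node _ _) X~ 0~ {suc x} {zero}  x≤ _  =
      mk⇔ (λ e → trans (to (X~ x≤ ≤-refl) e) (sym 0~)) (λ e → from (X~ x≤ ≤-refl) (trans e 0~))
    low-kernel X@(node _ _) X~ 0~ {suc x} {suc y} x≤ y≤ = X~ x≤ y≤
    kernel : ∀ {x y} → x < suc m → y < suc m → Side i x → Side i y → label (node X Q) x ≡ label (node X Q) y ⇔ l x ≡ l y
    kernel x< y< (low x≤) (low y≤) = mk⇔ (to k ∘ to j) (from j ∘ from k)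
      where
      j = label-low-≡ X Q x≤ y≤
      k = low-kernel X X~ 0~i x≤ y≤
    kernel x< y< (high x refl) (high y refl) = mk⇔ (to k ∘ to j) (from j ∘ from k)
      where
      j = label-high-≡ X Q {x′ = x} {y} refl refl
      k = Q~ (rest x<) (rest y<)
    kernel x< y< (low x≤) (high y refl) = mk⇔
      (λ e → contradiction (≤-trans (m≤m+n (suc i) y) (low-closed X Q x≤ e)) 1+n≰n)
      (λ e → contradiction e (separated x≤ (m≤m+n (suc i) y) (≤-pred y<)))
    kernel x< y< (high x refl) (low y≤) = mk⇔
      (λ e → contradiction (≤-trans (m≤m+n (suc i) x) (low-closed X Q y≤ (sym e))) 1+n≰n)
      (λ e → contradiction (sym e) (separated y≤ (m≤m+n (suc i) x) (≤-pred x<)))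

  decode : ∀ n (l : ℕ → A) → NoncrossingBelow n l → ∃ λ t → size t ≡ n × SameKernel n (label t) l
  decode = <-rec _ step
    where
    step : ∀ n → (∀ {k} → k < n → (l : ℕ → A) → NoncrossingBelow k l → ∃ λ t → size t ≡ k × SameKernel k (label t) l) →
           (l : ℕ → A) → NoncrossingBelow n l → ∃ λ t → size t ≡ n × SameKernel n (label t) l
    step zero    _   l nc = leaf , refl , λ ()
    step (suc m) rec l nc with last-index m (λ x → l 0 ≟ᴬ l x) refl
    ... | i , i≤m , 0~i , none = decode-node m l nc i i≤m 0~i none
      (rec (s≤s i≤m) (l ∘ suc) λ a<b b<c c<d d< → nc (s≤s a<b) (s≤s b<c) (s≤s c<d) (≤-trans (s≤s d<) (s≤s i≤m)))
      (rec (s≤s (m∸n≤m m i)) (λ x → l (suc i + x)) λ a<b b<c c<d d< →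
        nc (+-monoʳ-< (suc i) a<b) (+-monoʳ-< (suc i) b<c) (+-monoʳ-< (suc i) c<d)
           (s≤s (subst (i + _ <_) (m+[n∸m]≡n i≤m) (+-monoʳ-< i d<))))

-- Noncrossing partitions as kernels of labellings

module _ {n : ℕ} where

  Together : NoncrossingPartition n → Fin n → Fin n → Set
  Together π x y = ∃ λ B → B ∈ NoncrossingPartition.blocks π × x Subset.∈ B × y Subset.∈ B

  Together-cong : ∀ π ν → π ≈ᴺ ν → ∀ {x y} → Together π x y → Together ν x y
  Together-cong π ν π≈ν (B , B∈ , xy∈) = B , to (π≈ν B) B∈ , xy∈

  -- A block consists of everything that is together with any one of its elements.
  Together⇒≈ᴺ : ∀ π ν → (∀ {x y} → Together π x y ⇔ Together ν x y) → π ≈ᴺ ν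
  Together⇒≈ᴺ π ν same B = mk⇔ (half π ν (to same) (from same)) (half ν π (from same) (to same))
    where
    open NoncrossingPartition
    ⊆-block : ∀ π ν → (∀ {x y} → Together π x y → Together ν x y) → ∀ {B C x} →
              B ∈ blocks π → C ∈ blocks ν → x Subset.∈ B → x Subset.∈ C → B ⊆ C
    ⊆-block π ν imp B∈ C∈ x∈B x∈C y∈B with imp (_ , B∈ , x∈B , y∈B)
    ... | D , D∈ , x∈D , y∈D = subst (_ Subset.∈_) (same-block (isSetPartition ν) D∈ C∈ x∈D x∈C) y∈D
    half : ∀ π ν → (∀ {x y} → Together π x y → Together ν x y) → (∀ {x y} → Together ν x y → Together π x y) →
           ∀ {B} → B ∈ blocks π → B ∈ blocks ν
    half π ν imp imp′ B∈ with nonempty π B∈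
    ... | x , x∈B with covers ν x
    ...   | C , C∈ , x∈C = subst (_∈ blocks ν)
      (Subset.⊆-antisym (⊆-block ν π imp′ C∈ B∈ x∈C x∈B) (⊆-block π ν imp B∈ C∈ x∈B x∈C)) C∈

  module _ (π : NoncrossingPartition n) where
    open NoncrossingPartition π

    -- The blocks themselves serve as labels; outside {0, ..., n - 1} the value is a mere default.
    blockAt : ℕ → Subset n
    blockAt x with x <? n
    ... | yes x<n = proj₁ (covers (fromℕ< x<n))
    ... | no  _   = Subset.⊥

    blockAt-∈ : ∀ x → blockAt (toℕ x) ∈ blocks × x Subset.∈ blockAt (toℕ x)
    blockAt-∈ x with toℕ x <? n
    ... | no  x≮n = contradiction (Fin.toℕ<n x) x≮n
    ... | yes x<n with proj₂ (covers (fromℕ< x<n))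
    ...   | B∈ , x∈ = B∈ , subst (Subset._∈ proj₁ (covers (fromℕ< x<n))) (Fin.fromℕ<-toℕ x x<n) x∈

    blockAt-Together : ∀ {x y} → Together π x y ⇔ blockAt (toℕ x) ≡ blockAt (toℕ y)
    blockAt-Together {x} {y} with blockAt-∈ x | blockAt-∈ y
    ... | Bx∈ , x∈ | By∈ , y∈ = mk⇔
      (λ (B , B∈ , x∈B , y∈B) → trans (same-block isSetPartition Bx∈ B∈ x∈ x∈B) (same-block isSetPartition B∈ By∈ y∈B y∈))
      (λ e → blockAt (toℕ x) , Bx∈ , x∈ , subst (y Subset.∈_) (sym e) y∈)

    blockAt-noncrossing : NoncrossingBelow n blockAt
    blockAt-noncrossing {a} {b} {c} {d} a<b b<c c<d d<n a~c b~d
      with fromℕ< a<n | fromℕ< b<n | fromℕ< c<n | fromℕ< d<n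
         | Fin.toℕ-fromℕ< a<n | Fin.toℕ-fromℕ< b<n | Fin.toℕ-fromℕ< c<n | Fin.toℕ-fromℕ< d<n
      where
      c<n = <-trans c<d d<n
      b<n = <-trans b<c c<n
      a<n = <-trans a<b b<n
    ... | i | j | k | l | refl | refl | refl | refl with blockAt (toℕ i) ≟ˢ blockAt (toℕ j)
    ...   | yes e = e
    ...   | no ne = contradiction
      ( proj₂ (blockAt-∈ i) , subst (k Subset.∈_) (sym a~c) (proj₂ (blockAt-∈ k))
      , proj₂ (blockAt-∈ j) , subst (l Subset.∈_) (sym b~d) (proj₂ (blockAt-∈ l)))
      (noncrossing (proj₁ (blockAt-∈ i)) (proj₁ (blockAt-∈ j)) ne i j k l a<b b<c c<d)

-- Surjectivity onto {0, ..., k - 1} makes the fibres nonempty and therefore distinct, so the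
-- partition has exactly `k` blocks.
module Fibres {n k : ℕ} (l : ℕ → ℕ) (bounded : ∀ {x} → x < n → l x < k)
  (onto : ∀ {c} → c < k → ∃ λ x → x < n × l x ≡ c) (nc : NoncrossingBelow n l) where

  fibre : ℕ → Subset n
  fibre c = tabulate λ x → does (l (toℕ x) ≟ c)

  ∈-fibre⁺ : ∀ {x c} → l (toℕ x) ≡ c → x Subset.∈ fibre c
  ∈-fibre⁺ {x} {c} e = Vec.lookup⇒[]= x (fibre c)
    (trans (Vec.lookup∘tabulate (λ x → does (l (toℕ x) ≟ c)) x) (dec-true (l (toℕ x) ≟ c) e))

  ∈-fibre⁻ : ∀ {x c} → x Subset.∈ fibre c → l (toℕ x) ≡ c
  ∈-fibre⁻ {x} {c} x∈ with l (toℕ x) ≟ c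
  ... | yes e  = e
  ... | no  ne with trans (sym (dec-false (l (toℕ x) ≟ c) ne))
                      (trans (sym (Vec.lookup∘tabulate (λ x → does (l (toℕ x) ≟ c)) x)) (Vec.[]=⇒lookup x∈))
  ...   | ()

  fibres : List (Subset n)
  fibres = applyUpTo fibre k

  fibre-nonempty : ∀ {c} → c < k → Subset.Nonempty (fibre c)
  fibre-nonempty c<k with onto c<k
  ... | x , x<n , refl = fromℕ< x<n , ∈-fibre⁺ (cong l (Fin.toℕ-fromℕ< x<n))

  partition : NoncrossingPartition n
  partition = ncp fibres
    record
      { unique   = Unique.applyUpTo⁺₁ fibre k λ i<j j<k e → let x , x∈ = fibre-nonempty j<k in
                     <⇒≢ i<j (trans (sym (∈-fibre⁻ (subst (x Subset.∈_) (sym e) x∈))) (∈-fibre⁻ x∈))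
      ; nonempty = ne
      ; disjoint = di
      ; covers   = λ x → fibre (l (toℕ x)) , ∈-applyUpTo⁺ fibre (bounded (Fin.toℕ<n x)) , ∈-fibre⁺ refl
      } ncr
    where
    ne : ∀ {B} → B ∈ fibres → Subset.Nonempty B
    ne B∈ with ∈-applyUpTo⁻ fibre B∈
    ... | _ , c<k , refl = fibre-nonempty c<k
    di : ∀ {B C} → B ∈ fibres → C ∈ fibres → B ≢ C → Subset.Empty (B Subset.∩ C)
    di B∈ C∈ B≢C (x , x∈) with ∈-applyUpTo⁻ fibre B∈ | ∈-applyUpTo⁻ fibre C∈
    ... | b , _ , refl | c , _ , refl with Subset.x∈p∩q⁻ (fibre b) (fibre c) x∈
    ...   | x∈b , x∈c = B≢C (cong fibre (trans (sym (∈-fibre⁻ x∈b)) (∈-fibre⁻ x∈c)))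
    ncr : Noncrossing fibres
    ncr B∈ C∈ B≢C w x y z w<x x<y y<z (w∈ , y∈ , x∈ , z∈) with ∈-applyUpTo⁻ fibre B∈ | ∈-applyUpTo⁻ fibre C∈
    ... | b , _ , refl | c , _ , refl = B≢C (cong fibre (trans (sym (∈-fibre⁻ w∈)) (trans
      (nc w<x x<y y<z (Fin.toℕ<n z) (trans (∈-fibre⁻ w∈) (sym (∈-fibre⁻ y∈))) (trans (∈-fibre⁻ x∈) (sym (∈-fibre⁻ z∈))))
      (∈-fibre⁻ x∈))))

  bk-partition : bk partition ≡ k
  bk-partition = length-applyUpTo fibre k

  partition-Together : ∀ {x y} → Together partition x y ⇔ l (toℕ x) ≡ l (toℕ y)
  partition-Together {x} {y} = mk⇔ fwd
    (λ e → fibre (l (toℕ x)) , ∈-applyUpTo⁺ fibre (bounded (Fin.toℕ<n x)) , ∈-fibre⁺ refl , ∈-fibre⁺ (sym e))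
    where
    fwd : Together partition x y → l (toℕ x) ≡ l (toℕ y)
    fwd (B , B∈ , x∈ , y∈) with ∈-applyUpTo⁻ fibre B∈
    ... | c , _ , refl = trans (∈-fibre⁻ x∈) (sym (∈-fibre⁻ y∈))

partitionOf : ∀ {n} t → size t ≡ n → NoncrossingPartition n
partitionOf t refl = Fibres.partition (label t) (label-< t) (label-surjective t) (label-noncrossing t)

rank-partitionOf : ∀ {n} t (e : size t ≡ n) → n ∸ bk (partitionOf t e) ≡ rk t
rank-partitionOf t refl = trans
  (cong₂ _∸_ (sym (leaves+rk t)) (Fibres.bk-partition (label t) (label-< t) (label-surjective t) (label-noncrossing t)))
  (m+n∸m≡n (leaves t) (rk t))

partitionOf-Together : ∀ {n} t (e : size t ≡ n) {x y} →
                       Together (partitionOf t e) x y ⇔ label t (toℕ x) ≡ label t (toℕ y)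
partitionOf-Together t refl =
  Fibres.partition-Together (label t) (label-< t) (label-surjective t) (label-noncrossing t)

sameKernel-Fin : ∀ {A B : Set} {n} {l : ℕ → A} {l′ : ℕ → B} →
  (∀ (i j : Fin n) → l (toℕ i) ≡ l (toℕ j) ⇔ l′ (toℕ i) ≡ l′ (toℕ j)) → SameKernel n l l′
sameKernel-Fin h x<n y<n with fromℕ< x<n | fromℕ< y<n | Fin.toℕ-fromℕ< x<n | Fin.toℕ-fromℕ< y<n
... | i | j | refl | refl = h i j

partitionOf-injective : ∀ {n s t} (es : size s ≡ n) (et : size t ≡ n) → partitionOf s es ≈ᴺ partitionOf t et → s ≡ t
partitionOf-injective {n} {s} {t} refl et e = label-injective s t (sym et) (sameKernel-Fin λ i j → mk⇔
  (to (partitionOf-Together t et) ∘ Together-cong ps pt e ∘ from (partitionOf-Together s refl))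
  (to (partitionOf-Together s refl) ∘ Together-cong pt ps e′ ∘ from (partitionOf-Together t et)))
  where
  ps = partitionOf s refl
  pt = partitionOf t et
  e′ : pt ≈ᴺ ps
  e′ B = mk⇔ (from (e B)) (to (e B))

partitionOf-surjective : ∀ {n} (π : NoncrossingPartition n) → ∃ λ t → ∃ λ (e : size t ≡ n) → π ≈ᴺ partitionOf t e
partitionOf-surjective {n} π with decode _≟ˢ_ n (blockAt π) (blockAt-noncrossing π)
... | t , e , same = t , e , Together⇒≈ᴺ π (partitionOf t e) λ {x} {y} →
  let same-xy = same (Fin.toℕ<n x) (Fin.toℕ<n y) in mk⇔
    (from (partitionOf-Together t e) ∘ from same-xy ∘ to (blockAt-Together π))
    (from (blockAt-Together π) ∘ to same-xy ∘ to (partitionOf-Together t e))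

-- Enumeration of noncrossing partitions by forests

module _ {m : ℕ} (D : ChainDecomposition m) where
  open ChainDecomposition D
  open RankedPoset (NCᴬ (suc m)) using (rank; rank-cong; _∈≈_; Unique≈)
  open Enumerate {P = λ t → size t ≡ suc m} (λ t → size t ≟ suc m) partitionOf

  NCᴬ-enumerated : ∀ π → π ∈≈ enumerate trees
  NCᴬ-enumerated π =
    let t , e , π≈ = partitionOf-surjective π
    in enumerate-any {Q = π ≈ᴺ_} {xs = trees}
         (lose {P = λ t → size t ≡ suc m × ∀ e → π ≈ᴺ partitionOf t e} (covered t e)
           -- The enumeration may carry another proof of the size equation; all such proofs are
           -- equal.
           (e , λ e′ → subst (λ e → π ≈ᴺ partitionOf t e) (≡-irrelevant e e′) π≈))

  NCᴬ-once : Unique≈ (enumerate trees)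
  NCᴬ-once = enumerate-pairs (AllPairs.map (λ s≢t es et e → s≢t (partitionOf-injective es et e)) once)

  NCᴬ-level : ∀ k → level rank k (enumerate trees) ≡ level rk k trees
  NCᴬ-level k = go sized
    where
    go : ∀ {ts} → All (λ t → size t ≡ suc m) ts → level rank k (enumerate ts) ≡ level rk k ts
    go [] = refl
    go {t ∷ ts} (e ∷ es) with size t ≟ suc m
    ... | no  ne = contradiction e ne
    ... | yes e′ = level-∷ rank rk k {partitionOf t e′} {t} {enumerate ts} {ts} (rank-partitionOf t e′) (go es)

  NCᴬ-rankSize : ∀ k → rankSize (NCᴬ (suc m)) k ≡ level rk k trees
  NCᴬ-rankSize k = trans (rankSize-enumeration (NCᴬ (suc m)) NCᴬ-once NCᴬ-enumerated k) (NCᴬ-level k)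

  NCᴬ-maxRank : maxRank (NCᴬ (suc m)) ≡ m
  NCᴬ-maxRank = maxRank-≡ (NCᴬ (suc m)) bounded
    (partitionOf (comb m) (size-comb m) , trans (rank-partitionOf (comb m) (size-comb m)) (rk-comb m))
    where
    bounded : ∀ π → rank π ≤ m
    bounded π =
      let t , e , π≈ = partitionOf-surjective π
      in ≤-trans (≤-reflexive (trans (rank-cong {π} {partitionOf t e} π≈) (rank-partitionOf t e)))
           (All.lookup (All.concat⁺ (All.map (Chains.rank-≤ rk _⊑_) symmetric)) (covered t e))

-- Equality of the rank generating functions

rankGeneratingFunction-cong : ∀ {P Q m} → maxRank P ≡ m → maxRank Q ≡ m → (∀ k → rankSize P k ≡ rankSize Q k) →
                              rankGeneratingFunction P ≡ rankGeneratingFunction Q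
rankGeneratingFunction-cong {P} {Q} eP eQ same =
  trans (map-cong same (upTo (suc (maxRank P)))) (cong (λ m → map (rankSize Q) (upTo (suc m))) (trans eP (sym eQ)))

decomposition⇒corollary : ∀ {m} → ChainDecomposition m →
  RankSymmetric (Pᴬ (suc m)) × RankUnimodal (Pᴬ (suc m)) × StronglySperner (Pᴬ (suc m))
  × rankGeneratingFunction (Pᴬ (suc m)) ≡ rankGeneratingFunction (NCᴬ (suc m))
decomposition⇒corollary {m} D = rankSymmetric , rankUnimodal , stronglySperner
  , rankGeneratingFunction-cong {Pᴬ (suc m)} {NCᴬ (suc m)} maxRank≡r (NCᴬ-maxRank D)
      (λ k → trans (Pᴬ-rankSize D k) (sym (NCᴬ-rankSize D k)))
  where open Pᴬ-decomposition D

corollary1 : (n : ℕ) → 1 ≤ n →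
    RankSymmetric (Pᴬ n)
    × RankUnimodal (Pᴬ n)
    × StronglySperner (Pᴬ n)
    × rankGeneratingFunction (Pᴬ n) ≡ rankGeneratingFunction (NCᴬ n)
corollary1 (suc m) _ = decomposition⇒corollary (decomposition m)
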